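{- Let $0<|q|<1$, let $N,n,m$ be integers with $N\ge n\ge m>0$, and let $a,b,c\in\mathbb{C}$ be such that no denominator below vanishes. Then \[ {}_8W_7\!\left(abq;\,bq,\,aq/c,\,abq^{N+2},\,q^{ -n},\,q^{ -m};\,q,\,cq^{m+n-N}\right) \] \[ =\frac{(cq^{n-N}/a,\;q^{n-N}/b;q)_{N-n}\,(abq^2,\;q^{ -n},\;cq^{n-N};q)_m}{(q^{ -1-N}/(ab),\;cq^{2n-N+1};q)_{N-n}\,(aq,\;q^{ -N},\;bcq;q)_m}\; {}_8W_7\!\left(cq^{2n-N};\,cq^{m+n-N},\,q^{1+n},\,aq^{1+n},\,bcq^{1+n},\,q^{n-N};\,q,\,\frac{1}{abq^{1+n+m}}\right). \]
   Context: $(x;q)_k=\prod_{j=0}^{k-1}(1-xq^j)$ for integers $k\ge0$, $(x_1,\dots,x_r;q)_k=\prod_i(x_i;q)_k$. The very-well-poised series is \[ {}_{r+1}W_r(a_1;a_4,\dots,a_{r+1};q,z)=\sum_{k\ge0}\frac{1-a_1q^{2k}}{1-a_1}\,\frac{(a_1,a_4,\dots,a_{r+1};q)_k}{(q,a_1q/a_4,\dots,a_1q/a_{r+1};q)_k}\,z^k; \] both series above terminate (because of the parameters $q^{ -m}$ resp. $q^{n-N}$). The paper presents this as the dual form of the orthogonality relation of the $q$-Racah polynomials. -}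

module Defs where

open import Level using (Level; _⊔_) renaming (suc to lsuc)
open import Algebra.Bundles using (CommutativeRing)
open import Data.Nat using (ℕ; zero; suc)
open import Data.Integer using (ℤ; +_; -[1+_])
open import Data.List using (List; []; _∷_)
open import Relation.Nullary using (¬_)
open import Data.Product using (_×_)

record Field (c ℓ : Level) : Set (lsuc (c ⊔ ℓ)) where
  field
    commutativeRing : CommutativeRing c ℓ
  open CommutativeRing commutativeRing public
  field
    _⁻¹       : Carrier → Carrier
    ⁻¹-inverse : ∀ x → ¬ (x ≈ 0#) → x * (x ⁻¹) ≈ 1#
    0≉1        : ¬ (0# ≈ 1#)

module FieldOps {c ℓ : Level} (F : Field c ℓ) where
  open Field F public hiding (zero)

  -- x / y := x * y⁻¹ (only meaningful when y ≉ 0)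
  _/_ : Carrier → Carrier → Carrier
  x / y = x * (y ⁻¹)

  _^_ : Carrier → ℕ → Carrier
  x ^ zero = 1#
  x ^ suc k = (x ^ k) * x

  _^ℤ_ : Carrier → ℤ → Carrier
  x ^ℤ (+ k) = x ^ k
  x ^ℤ (-[1+ k ]) = (x ⁻¹) ^ suc k

  fromℕ : ℕ → Carrier
  fromℕ zero = 0#
  fromℕ (suc k) = 1# + fromℕ k

  CharZero : Set ℓ
  CharZero = ∀ k → ¬ (fromℕ (suc k) ≈ 0#)

  poch : Carrier → Carrier → ℕ → Carrier
  poch q x zero = 1#
  poch q x (suc k) = poch q x k * (1# - x * (q ^ k))

  pochs : Carrier → List Carrier → ℕ → Carrier
  pochs q [] k = 1#
  pochs q (x ∷ xs) k = poch q x k * pochs q xs k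

  dualParams : Carrier → Carrier → List Carrier → List Carrier
  dualParams q a₁ [] = []
  dualParams q a₁ (x ∷ xs) = ((a₁ * q) / x) ∷ dualParams q a₁ xs

  Wterm : Carrier → Carrier → List Carrier → Carrier → ℕ → Carrier
  Wterm q a₁ as z k =
    ((1# - a₁ * (q ^ (k Data.Nat.+ k))) / (1# - a₁))
    * ((poch q a₁ k * pochs q as k)
       / (poch q q k * pochs q (dualParams q a₁ as) k))
    * (z ^ k)

  -- terminating very-well-poised series: sum of the terms k = 0, …, M
  -- (M is the termination index, e.g. M = m when some aᵢ = q^{-m})
  W : Carrier → Carrier → List Carrier → Carrier → ℕ → Carrier
  W q a₁ as z zero = Wterm q a₁ as z zero
  W q a₁ as z (suc M) = W q a₁ as z M + Wterm q a₁ as z (suc M)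

  W87 : Carrier → Carrier → Carrier → Carrier → Carrier → Carrier → Carrier
      → Carrier → ℕ → Carrier
  W87 q a₁ a₄ a₅ a₆ a₇ a₈ z M = W q a₁ (a₄ ∷ a₅ ∷ a₆ ∷ a₇ ∷ a₈ ∷ []) z M

  -- "the denominators of the terminating series do not vanish":
  -- 1 - a₁ ≉ 0, (q;q)_M ≉ 0 and (a₁q/aᵢ;q)_M ≉ 0 for every i
  -- (this implies the same for all k ≤ M)
  W87-defined : Carrier → Carrier → Carrier → Carrier → Carrier → Carrier
      → Carrier → ℕ → Set ℓ
  W87-defined q a₁ a₄ a₅ a₆ a₇ a₈ M =
    ¬ ((1# - a₁) ≈ 0#) ×
    (¬ (poch q q M ≈ 0#) ×
     ¬ (pochs q (dualParams q a₁ (a₄ ∷ a₅ ∷ a₆ ∷ a₇ ∷ a₈ ∷ [])) M ≈ 0#))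

{-# OPTIONS --safe #-}

-- By Watson's transformation each very-well-poised 8W7 is a product times a terminating balanced 4φ3:
-- the left one has q^-m and q^(n-N) as terminating parameters and length m, the right one has the same two
-- parameters and length N - n.  Sears' transformation turns the first 4φ3 into the second.
-- Watson follows from the terminating 6φ5 sum and the q-Saalschütz sum by interchanging two summations,
-- Sears from two applications of q-Saalschütz; the two sums themselves have q-WZ certificates.
-- The hypotheses allow (c;q)_m = 0, where the intermediate 4φ3 has a vanishing denominator, and equality in
-- the field is not decidable, so all these identities are stated with denominators cleared.

module Submission where

-- Sears' transformation preserves the length of a terminating sum, while the two series here have
-- lengths m and N - n. The 4φ3 contains q^-m and q^(n-N) on an equal footing, so either of them may
-- be taken as the parameter that fixes the length; passing from one reading to the other is a step
-- of its own. Two devices keep every term polynomial. Sums are taken against q-binomial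
-- coefficients, which absorb (q^-m;q)_k / (q;q)_k, and a lower parameter of the form q^(1-m)/z is
-- replaced by the complementary product (z;q)_(m-k) in the numerator. A q-WZ certificate is then a
-- polynomial identity for each term, and every interchange of sums is one identity between products
-- of q-binomial coefficients. Nonvanishing is used only for q itself, to read the series `W87` as
-- such sums, and for the final cancellation. The products cancelled there that are absent from the
-- stated denominator, namely (abq^(n+2);q)_m and (q^(n+1-m), cq^(n-N);q)_(N-n), are denominators of
-- one of the two series.

open import Defs
open import Level using (Level)
open import Algebra.Bundles using (CommutativeRing)
open import Data.Nat using (ℕ; zero; suc; _≤_; _<_; _∸_; z≤n; s≤s)
import Data.Nat as ℕ
import Data.Nat.Properties as ℕₚ
open import Data.Integer as ℤ using (ℤ; +_; -[1+_])
import Data.Integer.Properties as ℤₚ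
import Data.Integer.Tactic.RingSolver as ℤ-Solver
open import Data.List using (List; []; _∷_)
open import Data.Maybe using (Maybe; just; nothing)
open import Data.Product using (proj₁; proj₂)
import Data.Sign as Sign
open import Data.Sum using (inj₁; inj₂)
open import Relation.Nullary using (¬_; yes; no)
open import Relation.Binary.PropositionalEquality as ≡ using (_≡_)

-- Ring normalisation with integer coefficients

-- Equality in R is not decidable, so cancellations such as 1# - 1# must be detected on integer coefficients.
module IntegerSolver {c ℓ : Level} (R : CommutativeRing c ℓ) where
  open CommutativeRing R hiding (zero)
  open import Algebra.Properties.Semiring.Mult.TCOptimised semiring
    using (_×_; ×-homo-+; ×1-homo-*; 1+×)
  open import Algebra.Properties.Ring ring
  open import Relation.Binary.Reasoning.Setoid setoid
  open import Algebra.Solver.Ring.AlmostCommutativeRing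
    using (_-Raw-AlmostCommutative⟶_; fromCommutativeRing)

  ⟦_⟧ℤ : ℤ → Carrier
  ⟦ + n ⟧ℤ      = n × 1#
  ⟦ -[1+ n ] ⟧ℤ = - (suc n × 1#)

  ⊖-homo : ∀ m n → ⟦ m ℤ.⊖ n ⟧ℤ ≈ m × 1# - n × 1#
  ⊖-homo m zero = begin
    ⟦ m ℤ.⊖ 0 ⟧ℤ  ≡⟨ ≡.cong ⟦_⟧ℤ (ℤₚ.⊖-≥ {m} ℕ.z≤n) ⟩
    m × 1#        ≈⟨ +-identityʳ _ ⟨
    m × 1# + 0#   ≈⟨ +-congˡ -0#≈0# ⟨
    m × 1# - 0#   ∎
  ⊖-homo zero (suc n) = sym (+-identityˡ _)
  ⊖-homo (suc m) (suc n) = begin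
    ⟦ suc m ℤ.⊖ suc n ⟧ℤ            ≡⟨ ≡.cong ⟦_⟧ℤ (ℤₚ.[1+m]⊖[1+n]≡m⊖n m n) ⟩
    ⟦ m ℤ.⊖ n ⟧ℤ                    ≈⟨ ⊖-homo m n ⟩
    m × 1# - n × 1#                 ≈⟨ +-congʳ (+-identityˡ _) ⟨
    0# + m × 1# - n × 1#            ≈⟨ +-congʳ (+-congʳ (-‿inverseʳ 1#)) ⟨
    1# - 1# + m × 1# - n × 1#       ≈⟨ +-congʳ (+-assoc _ _ _) ⟩
    1# + (- 1# + m × 1#) - n × 1#   ≈⟨ +-congʳ (+-congˡ (+-comm _ _)) ⟩
    1# + (m × 1# - 1#) - n × 1#     ≈⟨ +-congʳ (+-assoc _ _ _) ⟨
    1# + m × 1# - 1# - n × 1#       ≈⟨ +-assoc _ _ _ ⟩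
    1# + m × 1# + (- 1# - n × 1#)   ≈⟨ +-congˡ (-‿+-comm 1# _) ⟩
    1# + m × 1# - (1# + n × 1#)     ≈⟨ +-cong (1+× m 1#) (-‿cong (1+× n 1#)) ⟨
    suc m × 1# - suc n × 1#         ∎

  +-homo : ∀ i j → ⟦ i ℤ.+ j ⟧ℤ ≈ ⟦ i ⟧ℤ + ⟦ j ⟧ℤ
  +-homo (+ m)    (+ n)    = ×-homo-+ 1# m n
  +-homo (+ m)    -[1+ n ] = ⊖-homo m (suc n)
  +-homo -[1+ m ] (+ n)    = trans (⊖-homo n (suc m)) (+-comm _ _)
  +-homo -[1+ m ] -[1+ n ] = begin
    - (suc (suc (m ℕ.+ n)) × 1#)      ≡⟨ ≡.cong (λ k → - (k × 1#)) (≡.cong suc (≡.sym (ℕₚ.+-suc m n))) ⟩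
    - ((suc m ℕ.+ suc n) × 1#)        ≈⟨ -‿cong (×-homo-+ 1# (suc m) (suc n)) ⟩
    - (suc m × 1# + suc n × 1#)       ≈⟨ -‿+-comm _ _ ⟨
    - (suc m × 1#) - (suc n × 1#)     ∎

  -◃-homo : ∀ n → ⟦ Sign.- ℤ.◃ n ⟧ℤ ≈ - (n × 1#)
  -◃-homo zero    = sym -0#≈0#
  -◃-homo (suc n) = refl
  *-homo : ∀ i j → ⟦ i ℤ.* j ⟧ℤ ≈ ⟦ i ⟧ℤ * ⟦ j ⟧ℤ
  *-homo (+ m) (+ n) = begin
    ⟦ Sign.+ ℤ.◃ (m ℕ.* n) ⟧ℤ  ≡⟨ ≡.cong ⟦_⟧ℤ (ℤₚ.+◃n≡+n (m ℕ.* n)) ⟩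
    (m ℕ.* n) × 1#             ≈⟨ ×1-homo-* m n ⟩
    m × 1# * n × 1#            ∎
  *-homo (+ m) -[1+ n ] = begin
    ⟦ Sign.- ℤ.◃ (m ℕ.* suc n) ⟧ℤ  ≈⟨ -◃-homo (m ℕ.* suc n) ⟩
    - ((m ℕ.* suc n) × 1#)         ≈⟨ -‿cong (×1-homo-* m (suc n)) ⟩
    - (m × 1# * suc n × 1#)        ≈⟨ -‿distribʳ-* _ _ ⟩
    m × 1# * - (suc n × 1#)        ∎
  *-homo -[1+ m ] (+ n) = begin
    ⟦ Sign.- ℤ.◃ (suc m ℕ.* n) ⟧ℤ  ≈⟨ -◃-homo (suc m ℕ.* n) ⟩
    - ((suc m ℕ.* n) × 1#)         ≈⟨ -‿cong (×1-homo-* (suc m) n) ⟩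
    - (suc m × 1# * n × 1#)        ≈⟨ -‿distribˡ-* _ _ ⟩
    - (suc m × 1#) * n × 1#        ∎
  *-homo -[1+ m ] -[1+ n ] = begin
    (suc m ℕ.* suc n) × 1#             ≈⟨ ×1-homo-* (suc m) (suc n) ⟩
    suc m × 1# * suc n × 1#            ≈⟨ -‿involutive _ ⟨
    - (- (suc m × 1# * suc n × 1#))    ≈⟨ -‿cong (-‿distribˡ-* _ _) ⟩
    - (- (suc m × 1#) * suc n × 1#)    ≈⟨ -‿distribʳ-* _ _ ⟩
    - (suc m × 1#) * - (suc n × 1#)    ∎

  -‿homo : ∀ i → ⟦ ℤ.- i ⟧ℤ ≈ - ⟦ i ⟧ℤ
  -‿homo (+ zero)  = sym -0#≈0#
  -‿homo (+ suc n) = refl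
  -‿homo -[1+ n ]  = sym (-‿involutive _)

  ℤ-morphism : ℤ.+-*-rawRing -Raw-AlmostCommutative⟶ fromCommutativeRing R
  ℤ-morphism = record
    { ⟦_⟧ = ⟦_⟧ℤ ; +-homo = +-homo ; *-homo = *-homo ; -‿homo = -‿homo ; 0-homo = refl ; 1-homo = refl }

  -- Distinct integers may have the same image in `R`, so a negative test yields no information.
  coefficient-dec : ∀ i j → Maybe (⟦ i ⟧ℤ ≈ ⟦ j ⟧ℤ)
  coefficient-dec i j with i ℤ.≟ j
  ... | yes ≡.refl = just refl
  ... | no  _      = nothing

  open import Algebra.Solver.Ring ℤ.+-*-rawRing (fromCommutativeRing R) ℤ-morphism coefficient-dec public
    using (Polynomial; solve; con; _:+_; _:*_; _:-_; :-_; _:=_)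

  :0 :1 : ∀ {n} → Polynomial n
  :0 = con (+ 0)
  :1 = con (+ 1)

-- Cancellation and integer powers in a field

module FieldProperties {ℓc ℓ : Level} (F : Field ℓc ℓ) where
  open FieldOps F
  open IntegerSolver commutativeRing
  open import Relation.Binary.Reasoning.Setoid setoid

  ^-cong : ∀ {x y} k → x ≈ y → x ^ k ≈ y ^ k
  ^-cong zero    x≈y = refl
  ^-cong (suc k) x≈y = *-cong (^-cong k x≈y) x≈y

  ^-+ : ∀ x m n → x ^ (m ℕ.+ n) ≈ (x ^ m) * (x ^ n)
  ^-+ x zero    n = sym (*-identityˡ _)
  ^-+ x (suc m) n = begin
    (x ^ (m ℕ.+ n)) * x        ≈⟨ *-congʳ (^-+ x m n) ⟩
    (x ^ m) * (x ^ n) * x      ≈⟨ solve 3 (λ a b x → a :* b :* x := a :* x :* b) refl _ _ _ ⟩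
    (x ^ m) * x * (x ^ n)      ∎

  ^-* : ∀ x y k → (x * y) ^ k ≈ (x ^ k) * (y ^ k)
  ^-* x y zero    = sym (*-identityˡ _)
  ^-* x y (suc k) = trans (*-congʳ (^-* x y k)) (solve 4 (λ a b x y →
          a :* b :* (x :* y)
          := a :* x :* (b :* y)) refl
         _ _ _ _)

  *-cancelˡ-≉0 : ∀ {x y z} → ¬ x ≈ 0# → x * y ≈ x * z → y ≈ z
  *-cancelˡ-≉0 {x} {y} {z} x≉0 xy≈xz = begin
    y                ≈⟨ *-identityˡ y ⟨
    1# * y           ≈⟨ *-congʳ inv ⟨
    (x ⁻¹) * x * y   ≈⟨ *-assoc _ _ _ ⟩
    (x ⁻¹) * (x * y) ≈⟨ *-congˡ xy≈xz ⟩
    (x ⁻¹) * (x * z) ≈⟨ *-assoc _ _ _ ⟨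
    (x ⁻¹) * x * z   ≈⟨ *-congʳ inv ⟩
    1# * z           ≈⟨ *-identityˡ z ⟩
    z                ∎
    where inv = trans (*-comm _ _) (⁻¹-inverse x x≉0)

  *-≉0 : ∀ {x y} → ¬ x ≈ 0# → ¬ y ≈ 0# → ¬ x * y ≈ 0#
  *-≉0 x≉0 y≉0 xy≈0 = y≉0 (*-cancelˡ-≉0 x≉0 (trans xy≈0 (sym (zeroʳ _))))

  ≉0-factorˡ : ∀ {x y} → ¬ x * y ≈ 0# → ¬ x ≈ 0#
  ≉0-factorˡ xy≉0 x≈0 = xy≉0 (trans (*-congʳ x≈0) (zeroˡ _))

  ≉0-factorʳ : ∀ {x y} → ¬ x * y ≈ 0# → ¬ y ≈ 0#
  ≉0-factorʳ xy≉0 y≈0 = xy≉0 (trans (*-congˡ y≈0) (zeroʳ _))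

  ≉0-resp : ∀ {x y} → x ≈ y → ¬ x ≈ 0# → ¬ y ≈ 0#
  ≉0-resp x≈y x≉0 y≈0 = x≉0 (trans x≈y y≈0)

  /-*-cancel : ∀ x {y} → ¬ y ≈ 0# → (x / y) * y ≈ x
  /-*-cancel x {y} y≉0 = begin
    x * (y ⁻¹) * y    ≈⟨ solve 3 (λ x i y → x :* i :* y := x :* (y :* i)) refl _ _ _ ⟩
    x * (y * (y ⁻¹))  ≈⟨ *-congˡ (⁻¹-inverse y y≉0) ⟩
    x * 1#            ≈⟨ *-identityʳ x ⟩
    x                 ∎

  *-unique-/ : ∀ {x y z} → ¬ y ≈ 0# → x ≈ y * z → x / y ≈ z
  *-unique-/ {x} {y} {z} y≉0 x≈yz = *-cancelˡ-≉0 y≉0 (trans (*-comm _ _) (trans (/-*-cancel x y≉0) x≈yz))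

  1≉0 : ¬ 1# ≈ 0#
  1≉0 1≈0 = 0≉1 (sym 1≈0)

  unitˡ-≉0 : ∀ {x y} → x * y ≈ 1# → ¬ x ≈ 0#
  unitˡ-≉0 xy≈1 = ≉0-factorˡ (≉0-resp (sym xy≈1) 1≉0)

  unitʳ-≉0 : ∀ {x y} → x * y ≈ 1# → ¬ y ≈ 0#
  unitʳ-≉0 xy≈1 = ≉0-factorʳ (≉0-resp (sym xy≈1) 1≉0)

  ^-≉0 : ∀ {x} k → ¬ x ≈ 0# → ¬ x ^ k ≈ 0#
  ^-≉0 zero    x≉0     = 1≉0
  ^-≉0 (suc k) x≉0     = *-≉0 (^-≉0 k x≉0) x≉0

  module _ {x : Carrier} (x≉0 : ¬ x ≈ 0#) where
    ^ℤ-⊖ : ∀ m n → x ^ℤ (m ℤ.⊖ n) ≈ (x ^ m) * ((x ⁻¹) ^ n)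
    ^ℤ-⊖ m       zero    = trans (reflexive (≡.cong (x ^ℤ_) (ℤₚ.⊖-≥ {m} z≤n))) (sym (*-identityʳ _))
    ^ℤ-⊖ zero    (suc n) = sym (*-identityˡ _)
    ^ℤ-⊖ (suc m) (suc n) = begin
      x ^ℤ (suc m ℤ.⊖ suc n)                   ≡⟨ ≡.cong (x ^ℤ_) (ℤₚ.[1+m]⊖[1+n]≡m⊖n m n) ⟩
      x ^ℤ (m ℤ.⊖ n)                           ≈⟨ ^ℤ-⊖ m n ⟩
      (x ^ m) * ((x ⁻¹) ^ n)                   ≈⟨ *-identityʳ _ ⟨
      (x ^ m) * ((x ⁻¹) ^ n) * 1#              ≈⟨ *-congˡ (⁻¹-inverse x x≉0) ⟨
      (x ^ m) * ((x ⁻¹) ^ n) * (x * (x ⁻¹))    ≈⟨ solve 4 (λ a b c d →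
              a :* b :* (c :* d)
              := a :* c :* (b :* d)) refl
             _ _ _ _ ⟩
      (x ^ suc m) * ((x ⁻¹) ^ suc n)           ∎

    ^ℤ-+ : ∀ i j → x ^ℤ (i ℤ.+ j) ≈ (x ^ℤ i) * (x ^ℤ j)
    ^ℤ-+ (+ m)    (+ n)    = ^-+ x m n
    ^ℤ-+ (+ m)    -[1+ n ] = ^ℤ-⊖ m (suc n)
    ^ℤ-+ -[1+ m ] (+ n)    = trans (^ℤ-⊖ n (suc m)) (*-comm _ _)
    ^ℤ-+ -[1+ m ] -[1+ n ] = trans
      (reflexive (≡.cong ((x ⁻¹) ^_) (≡.cong suc (≡.sym (ℕₚ.+-suc m n)))))
      (^-+ (x ⁻¹) (suc m) (suc n))

    -- Reduces an identity between powers with exponents such as n - N to a linear identity in ℤ.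
    ^ℤ-collect : ∀ i j {k} → i ℤ.+ j ≡ k → (x ^ℤ i) * (x ^ℤ j) ≈ x ^ℤ k
    ^ℤ-collect i j ≡.refl = sym (^ℤ-+ i j)

-- q-shifted factorials

module QSeries {ℓc ℓ : Level} (F : Field ℓc ℓ) (q : Field.Carrier F) where
  open FieldOps F
  open IntegerSolver commutativeRing
  open import Relation.Binary.Reasoning.Setoid setoid
  open FieldProperties F

  P : Carrier → ℕ → Carrier
  P = poch q

  P-cong : ∀ {x y} k → x ≈ y → P x k ≈ P y k
  P-cong zero    x≈y = refl
  P-cong (suc k) x≈y = *-cong (P-cong k x≈y) (+-congˡ (-‿cong (*-congʳ x≈y)))

  P-suc : ∀ x k → P x (suc k) ≈ (1# - x) * P (x * q) k
  P-suc x zero    = solve 1 (λ x → :1 :* (:1 :- x :* :1) := (:1 :- x) :* :1) refl x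
  P-suc x (suc k) = begin
    P x (suc k) * (1# - x * ((q ^ k) * q))               ≈⟨ *-congʳ (P-suc x k) ⟩
    (1# - x) * P (x * q) k * (1# - x * ((q ^ k) * q))
      ≈⟨ solve 4 (λ x q K p →
              (:1 :- x) :* p :* (:1 :- x :* (K :* q))
              := (:1 :- x) :* (p :* (:1 :- x :* q :* K))) refl
             x q (q ^ k) (P (x * q) k) ⟩
    (1# - x) * (P (x * q) k * (1# - x * q * (q ^ k)))    ∎

  P-+ : ∀ x j i → P x (j ℕ.+ i) ≈ P x j * P (x * (q ^ j)) i
  P-+ x zero    i = trans (P-cong i (sym (*-identityʳ x))) (sym (*-identityˡ _))
  P-+ x (suc j) i = begin
    P x (suc (j ℕ.+ i))                              ≈⟨ P-suc x (j ℕ.+ i) ⟩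
    (1# - x) * P (x * q) (j ℕ.+ i)                   ≈⟨ *-congˡ (P-+ (x * q) j i) ⟩
    (1# - x) * (P (x * q) j * P (x * q * (q ^ j)) i)  ≈⟨ *-assoc _ _ _ ⟨
    (1# - x) * P (x * q) j * P (x * q * (q ^ j)) i
      ≈⟨ *-cong (sym (P-suc x j)) (P-cong i (solve 3 (λ x q K → x :* q :* K := x :* (K :* q)) refl x q (q ^ j))) ⟩
    P x (suc j) * P (x * (q ^ suc j)) i              ∎

  -- Sums against q-binomial coefficients

  -- Q m f is the sum of [m choose j]_q · f j i over j + i = m: iterating q-Pascal's rule on f avoids the
  -- q-binomial coefficients, which makes Q-assoc the revision identity for products of two of them.
  Q : ℕ → (ℕ → ℕ → Carrier) → Carrier
  Q zero    f = f 0 0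
  Q (suc m) f = Q m (λ j i → (q ^ j) * f j (suc i) + f (suc j) i)

  Q-cong : ∀ m {f g} → (∀ j i → j ℕ.+ i ≡ m → f j i ≈ g j i) → Q m f ≈ Q m g
  Q-cong zero    f≈g = f≈g 0 0 ≡.refl
  Q-cong (suc m) f≈g = Q-cong m λ j i eq →
    +-cong (*-congˡ (f≈g j (suc i) (≡.trans (ℕₚ.+-suc j i) (≡.cong suc eq)))) (f≈g (suc j) i (≡.cong suc eq))

  Q-+ : ∀ m f g → Q m (λ j i → f j i + g j i) ≈ Q m f + Q m g
  Q-+ zero    f g = refl
  Q-+ (suc m) f g = trans
    (Q-cong m λ j i _ → solve 5 (λ k a b c d →
            k :* (a :+ b) :+ (c :+ d)
            := (k :* a :+ c) :+ (k :* b :+ d)) refl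
           (q ^ j) _ _ _ _)
    (Q-+ m _ _)

  Q-*ˡ : ∀ m c f → Q m (λ j i → c * f j i) ≈ c * Q m f
  Q-*ˡ zero    c f = refl
  Q-*ˡ (suc m) c f = trans
    (Q-cong m λ j i _ → solve 4 (λ k c a b → k :* (c :* a) :+ c :* b := c :* (k :* a :+ b)) refl (q ^ j) c _ _)
    (Q-*ˡ m c _)

  -- The other q-Pascal rule: here the weight q^i sits on the shifted term, whereas the definition
  -- of `Q` puts q^j on the unshifted one.
  Q-pascal : ∀ m f → Q (suc m) f ≈ Q m (λ j i → f j (suc i) + (q ^ i) * f (suc j) i)
  Q-pascal zero    f = solve 2 (λ a b → :1 :* a :+ b := a :+ :1 :* b) refl _ _
  Q-pascal (suc m) f = trans
    (Q-pascal m (λ j i → (q ^ j) * f j (suc i) + f (suc j) i))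
    (Q-cong m λ j i _ →
      solve 6 (λ J I q a b c →
              (J :* a :+ b) :+ I :* ((J :* q) :* b :+ c)
              := J :* (a :+ (I :* q) :* b) :+ (b :+ I :* c)) refl
        (q ^ j) (q ^ i) q _ _ _)

  -- The difference of the two q-Pascal rules. It is the index shift given by [m choose j] (1 -
  -- q^(m-j)) = [m choose j+1] (1 - q^(j+1)); no boundary terms arise, because the coefficient 1 -
  -- q^0 removes them at both ends.
  Q-telescope : ∀ m f →
    Q m (λ j i → (1# - (q ^ j)) * f j (suc i)) ≈ Q m (λ j i → (1# - (q ^ i)) * f (suc j) i)
  Q-telescope m f = begin
    Q m (λ j i → (1# - (q ^ j)) * f j (suc i))
      ≈⟨ Q-cong m (λ j i _ → solve 4 (λ J I a b →
              (:1 :- J) :* a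
              := (a :+ I :* b) :+ (:- :1 :* (J :* a :+ b) :+ (:1 :- I) :* b)) refl
             (q ^ j) (q ^ i) _ _) ⟩
    Q m (λ j i → (f j (suc i) + (q ^ i) * f (suc j) i)
               + (- 1# * ((q ^ j) * f j (suc i) + f (suc j) i) + (1# - (q ^ i)) * f (suc j) i))
      ≈⟨ trans (Q-+ m _ _) (+-congˡ (trans (Q-+ m _ _) (+-congʳ (Q-*ˡ m _ _)))) ⟩
    Q m (λ j i → f j (suc i) + (q ^ i) * f (suc j) i) + (- 1# * Q (suc m) f + Q m (λ j i → (1# - (q ^ i)) * f (suc j) i))
      ≈⟨ +-congʳ (Q-pascal m f) ⟨
    Q (suc m) f + (- 1# * Q (suc m) f + Q m (λ j i → (1# - (q ^ i)) * f (suc j) i))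
      ≈⟨ solve 2 (λ a b → a :+ (:- :1 :* a :+ b) := b) refl _ _ ⟩
    Q m (λ j i → (1# - (q ^ i)) * f (suc j) i) ∎

  -- (f , ψ) is a q-WZ pair; ψ j 0 only occurs with the coefficient 1 - q^0, so its value is irrelevant.
  Q-step : ∀ m c f ψ →
    (∀ j i → j ℕ.+ i ≡ m →
      f j (suc i) + (q ^ i) * f (suc j) i + (1# - (q ^ i)) * ψ (suc j) i ≈ c * f j i + (1# - (q ^ j)) * ψ j (suc i)) →
    Q (suc m) f ≈ c * Q m f
  Q-step m c f ψ certificate = begin
    Q (suc m) f ≈⟨ Q-pascal m f ⟩
    Q m (λ j i → f j (suc i) + (q ^ i) * f (suc j) i)
      ≈⟨ solve 2 (λ a b → a := a :+ b :- b) refl _ _ ⟩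
    Q m (λ j i → f j (suc i) + (q ^ i) * f (suc j) i) + Q m (λ j i → (1# - (q ^ i)) * ψ (suc j) i) - T
      ≈⟨ +-congʳ (Q-+ m _ _) ⟨
    Q m (λ j i → f j (suc i) + (q ^ i) * f (suc j) i + (1# - (q ^ i)) * ψ (suc j) i) - T
      ≈⟨ +-congʳ (Q-cong m certificate) ⟩
    Q m (λ j i → c * f j i + (1# - (q ^ j)) * ψ j (suc i)) - T
      ≈⟨ +-congʳ (trans (Q-+ m _ _) (+-cong (Q-*ˡ m c f) (Q-telescope m ψ))) ⟩
    c * Q m f + T - T ≈⟨ solve 2 (λ a b → a :+ b :- b := a) refl _ _ ⟩
    c * Q m f ∎
    where T = Q m (λ j i → (1# - (q ^ i)) * ψ (suc j) i)

  Q-assoc : ∀ m (f : ℕ → ℕ → ℕ → Carrier) →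
    Q m (λ j i → Q j (λ r t → f r t i)) ≈ Q m (λ r s → Q s (f r))
  Q-assoc zero    f = refl
  Q-assoc (suc m) f = begin
    Q m (λ j i → (q ^ j) * Q j (λ r t → f r t (suc i)) + Q (suc j) (λ r t → f r t i))
      -- The weight q^j of the outer sum splits as q^r q^t because j = r + t. One factor serves each
      -- of the two sums on the other side, so both sides obey the same recursion.
      ≈⟨ Q-cong m (λ j i _ → trans (+-congʳ (sym (Q-*ˡ j _ _))) (trans (sym (Q-+ j _ _)) (Q-cong j λ { r t ≡.refl →
           trans (+-congʳ (*-congʳ (^-+ q r t)))
           (solve 5 (λ R T a b c →
                   (R :* T) :* a :+ (R :* b :+ c)
                   := R :* (T :* a :+ b) :+ c) refl
                  (q ^ r) (q ^ t) _ _ _) }))) ⟩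
    Q m (λ j i → Q j (λ r t → (q ^ r) * ((q ^ t) * f r t (suc i) + f r (suc t) i) + f (suc r) t i))
      ≈⟨ Q-assoc m (λ r t i → (q ^ r) * ((q ^ t) * f r t (suc i) + f r (suc t) i) + f (suc r) t i) ⟩
    Q m (λ r s → Q s (λ t i → (q ^ r) * ((q ^ t) * f r t (suc i) + f r (suc t) i) + f (suc r) t i))
      ≈⟨ Q-cong m (λ r s _ → trans (Q-+ s _ _) (+-congʳ (Q-*ˡ s _ _))) ⟩
    Q m (λ r s → (q ^ r) * Q (suc s) (f r) + Q s (f (suc r))) ∎

  -- The q-Saalschütz sum

  -- This is 3φ2(b, c, q^-m; bcs, q^(1-m)/s; q, q) multiplied by (bcs, s;q)_m: s stands for the
  -- lower parameter divided by bc, and the other lower parameter is encoded by `P s i`.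
  saalschütz : ∀ m b c s →
    Q m (λ j i → P b j * P c j * P (b * c * s * (q ^ j)) i * P s i * (s ^ j)) ≈ P (b * s) m * P (c * s) m
  saalschütz zero b c s = solve 0 (:1 :* :1 :* :1 :* :1 :* :1 := :1 :* :1) refl
  saalschütz (suc m) b c s = begin
    Q (suc m) f                                           ≈⟨ Q-step m C f ψ certificate ⟩
    C * Q m f                                             ≈⟨ *-congˡ (saalschütz m b c s) ⟩
    C * (P (b * s) m * P (c * s) m)
      ≈⟨ solve 4 (λ x y u v → u :* v :* (x :* y) := x :* u :* (y :* v)) refl _ _ _ _ ⟩
    P (b * s) (suc m) * P (c * s) (suc m)                 ∎
    where
    f : ℕ → ℕ → Carrier
    f j i = P b j * P c j * P (b * c * s * (q ^ j)) i * P s i * (s ^ j)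

    -- `ψ j (suc i)` is `f j (suc i)` with the last factor 1 - bcs q^(j+i) of its third product
    -- replaced by -bcs q^(j+i).
    ψ : ℕ → ℕ → Carrier
    ψ j zero    = 0#
    ψ j (suc i) = - (b * c * s * (q ^ j) * (q ^ i))
      * (P b j * P c j * P (b * c * s * (q ^ j)) i * P s (suc i) * (s ^ j))

    -- The quotient of the right-hand sides for m + 1 and m.
    C : Carrier
    C = (1# - b * s * (q ^ m)) * (1# - c * s * (q ^ m))

    certificate : ∀ j i → j ℕ.+ i ≡ m →
      f j (suc i) + (q ^ i) * f (suc j) i + (1# - (q ^ i)) * ψ (suc j) i ≈ C * f j i + (1# - (q ^ j)) * ψ j (suc i)
    certificate j zero ≡.refl = begin
      f j 1 + 1# * f (suc j) 0 + (1# - 1#) * 0#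
        ≈⟨ solve 7 (λ b c s K B D S →
                B :* D :* (:1 :* (:1 :- b :* c :* s :* K :* :1)) :* (:1 :* (:1 :- s :* :1)) :* S
                   :+ :1 :* (B :* (:1 :- b :* K) :* (D :* (:1 :- c :* K)) :* :1 :* :1 :* (S :* s)) :+ (:1 :- :1) :* :0
                := (:1 :- b :* s :* K) :* (:1 :- c :* s :* K) :* (B :* D :* :1 :* :1 :* S)
                   :+ (:1 :- K) :* (:- (b :* c :* s :* K :* :1) :* (B :* D :* :1 :* (:1 :* (:1 :- s :* :1)) :* S))) refl
             b c s (q ^ j) (P b j) (P c j) (s ^ j) ⟩
      (1# - b * s * (q ^ j)) * (1# - c * s * (q ^ j)) * f j 0 + (1# - (q ^ j)) * ψ j 1
        ≈⟨ +-congʳ (*-congʳ (*-cong (+-congˡ (-‿cong (*-congˡ eq))) (+-congˡ (-‿cong (*-congˡ eq))))) ⟩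
      C * f j 0 + (1# - (q ^ j)) * ψ j 1 ∎
      where
      eq : q ^ j ≈ q ^ (j ℕ.+ 0)
      eq = trans (sym (*-identityʳ _)) (sym (^-+ q j 0))
    certificate j (suc i) ≡.refl = begin
      f j (suc (suc i)) + (q ^ suc i) * f (suc j) (suc i) + (1# - (q ^ suc i)) * ψ (suc j) (suc i)
        ≈⟨ +-cong (+-cong (*-congʳ (*-congʳ (*-congˡ (*-congʳ shift)))) (*-congˡ (*-congʳ (*-congʳ (*-congˡ (*-congʳ shift′))))))
                  (*-congˡ (*-congˡ (*-congʳ (*-congʳ (*-congˡ shift′))))) ⟩
      _ ≈⟨ solve 11 (λ b c s q K I B D U T S →
              B :* D :* ((:1 :- b :* c :* s :* K) :* U :* (:1 :- b :* c :* s :* K :* (I :* q))) :* (T :* (:1 :- s :* (I :* q))) :* S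
                 :+ (I :* q) :* (B :* (:1 :- b :* K) :* (D :* (:1 :- c :* K)) :* (U :* (:1 :- b :* c :* s :* (K :* q) :* I)) :* T :* (S :* s))
                 :+ (:1 :- I :* q) :* (:- (b :* c :* s :* (K :* q) :* I) :* (B :* (:1 :- b :* K) :* (D :* (:1 :- c :* K)) :* U :* T :* (S :* s)))
              := (:1 :- b :* s :* (K :* (I :* q))) :* (:1 :- c :* s :* (K :* (I :* q))) :* (B :* D :* ((:1 :- b :* c :* s :* K) :* U) :* T :* S)
                 :+ (:1 :- K) :* (:- (b :* c :* s :* K :* (I :* q)) :* (B :* D :* ((:1 :- b :* c :* s :* K) :* U) :* (T :* (:1 :- s :* (I :* q))) :* S))) refl
             b c s q (q ^ j) (q ^ i) (P b j) (P c j) (P (b * c * s * (q ^ j) * q) i) (P s (suc i)) (s ^ j) ⟩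
      _ ≈⟨ +-cong (*-cong (*-cong (+-congˡ (-‿cong (*-congˡ eq))) (+-congˡ (-‿cong (*-congˡ eq)))) (*-congʳ (*-congʳ (*-congˡ (sym shift)))))
                  (*-congˡ (*-congˡ (*-congʳ (*-congʳ (*-congˡ (sym shift)))))) ⟩
      C * f j (suc i) + (1# - (q ^ j)) * ψ j (suc (suc i)) ∎
      where
      eq : (q ^ j) * (q ^ suc i) ≈ q ^ (j ℕ.+ suc i)
      eq = sym (^-+ q j (suc i))
      -- Removing the first factor, not the last, leaves (bcsq^(j+1);q)_i in the terms for j and for
      -- j + 1 alike; what remains is a polynomial identity.
      shift : P (b * c * s * (q ^ j)) (suc i) ≈ (1# - b * c * s * (q ^ j)) * P (b * c * s * (q ^ j) * q) i
      shift = P-suc _ i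
      shift′ : P (b * c * s * (q ^ suc j)) i ≈ P (b * c * s * (q ^ j) * q) i
      shift′ = P-cong i (solve 3 (λ x K q → x :* (K :* q) := x :* K :* q) refl _ _ _)

  -- The terminating very-well-poised 6φ5 sum

  -- ε k = (-1)^k q^(k(k-1)/2)
  ε : ℕ → Carrier
  ε zero    = 1#
  ε (suc k) = ε k * (- (q ^ k))

  -- The parameter v is a / (de), so that evq and dvq are aq / d and aq / e.
  module SixPhiFive (d e v : Carrier) where
    a : Carrier
    a = d * e * v

    -- The k-th term of the 6φ5 with parameters a, d, e, q^-m and argument vq^(m+1), without
    -- [m choose k]_q and multiplied by 1 - a and (aq/d, aq/e, aq^(m+1);q)_m. The last product is
    -- (aq^(m+1+k);q)_i, written through k and i with m = k + i; the powers of q^m in the argument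
    -- are absorbed by (q^-m;q)_k, which leaves `ε k`.
    f : ℕ → ℕ → Carrier
    f k i = ε k * ((v * q) ^ k) * ((1# - a * ((q ^ k) * (q ^ k))) * P a k) * (P d k * P e k)
      * (P (e * v * q * (q ^ k)) i * P (d * v * q * (q ^ k)) i) * P (a * q * ((q ^ k) * (q ^ k) * (q ^ i))) i

    -- The polynomial part of the certificate. The case i = 0 of the WZ equation forces it: `φ` -
    -- `W₀` - `W₃` vanishes at K = 1, and `ρ` is its quotient by 1 - K.
    ρ : Carrier → Carrier → Carrier
    ρ x y = - (y * ((d + e) * v - a * (v * (x + y) + x - v * (a * (x * (x * y))))))

    -- The common factor of `f k (suc i)`, `ψ k (suc i)` and the multiple of `f k i` in the WZ
    -- equation; the cofactors are `φ`, `ρ` and `W₀`, with y = q^(k+i+1).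
    Z : ℕ → ℕ → Carrier
    Z k i = ε k * ((v * q) ^ k) * P a k * (P d k * P e k)
      * (P (e * v * q * (q ^ k)) i * P (d * v * q * (q ^ k)) i)
      * (P (a * q * ((q ^ k) * (q ^ k) * (q ^ suc i))) i
         * (1# - a * q * ((q ^ k) * (q ^ k) * (q ^ suc i)) * (q ^ i)))

    ψ : ℕ → ℕ → Carrier
    ψ k zero    = 0#
    ψ k (suc i) = Z k i * ρ (q ^ k) (q * ((q ^ k) * (q ^ i)))

    -- With M = q^m, the quotient of (a;q)_(2m+1) (vq;q)_m at m + 1 and at m.
    C : Carrier → Carrier
    C M = (1# - a * q * (M * M)) * (1# - a * q * (M * M * q)) * (1# - v * q * M)

    φ W₀ W₃ : Carrier → Carrier → Carrier
    φ K y = (1# - e * v * y) * (1# - d * v * y) * (1# - a * (K * K))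
    W₀ K y = (1# - v * y) * (1# - a * (K * K)) * (1# - a * (K * y))
    W₃ K y = v * y * ((1# - d * K) * (1# - e * K) * (1# - a * K))

    φ-split : ∀ K y → φ K y ≈ W₀ K y + (1# - K) * ρ K y + W₃ K y
    φ-split K y = solve 5 (λ d e v K y →
            (:1 :- e :* v :* y) :* (:1 :- d :* v :* y) :* (:1 :- d :* e :* v :* (K :* K))
            := (:1 :- v :* y) :* (:1 :- d :* e :* v :* (K :* K)) :* (:1 :- d :* e :* v :* (K :* y))
               :+ (:1 :- K) :* (:- (y :* ((d :+ e) :* v :- d :* e :* v :* (v :* (K :+ y) :+ K :- v :* (d :* e :* v :* (K :* (K :* y)))))))
               :+ v :* y :* ((:1 :- d :* K) :* (:1 :- e :* K) :* (:1 :- d :* e :* v :* K))) refl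
           d e v K y

    -- The test that the `ρ` found at i = 0 also works for i > 0: the shifted terms of `f` and `ψ`
    -- combine to a multiple of the three factors by which `Z j (suc i)` exceeds `Z₂`.
    ρ-divides : ∀ K I → I * φ (K * q) (q * (K * I)) + (1# - I) * ρ (K * q) (q * (K * I))
      ≈ I * ((1# - e * v * (K * q)) * (1# - d * v * (K * q)) * (1# - a * (K * q * (q * (K * I)))))
    ρ-divides K I = solve 7 (λ d e v a q K I →
            I :* ((:1 :- e :* v :* (q :* (K :* I))) :* (:1 :- d :* v :* (q :* (K :* I))) :* (:1 :- d :* e :* v :* (K :* q :* (K :* q))))
               :+ (:1 :- I) :* (:- (q :* (K :* I) :* ((d :+ e) :* v :- d :* e :* v :* (v :* (K :* q :+ q :* (K :* I)) :+ K :* q :- v :* (d :* e :* v :* (K :* q :* (K :* q :* (q :* (K :* I)))))))))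
            := I :* ((:1 :- e :* v :* (K :* q)) :* (:1 :- d :* v :* (K :* q)) :* (:1 :- d :* e :* v :* (K :* q :* (q :* (K :* I)))))) refl
           d e v a q K I

    module _ (j i : ℕ) where
      private
        K = q ^ j
        I = q ^ i
        y = q * (K * I)

      f-suc : f j (suc i) ≈ Z j i * φ K y
      f-suc = solve 15 (λ z1 z2 z3 z4 z5 z6 z7 z8 d e v a q K I →
              z1 :* z2 :* ((:1 :- a :* (K :* K)) :* z3) :* (z4 :* z5)
                 :* (z6 :* (:1 :- e :* v :* q :* K :* I) :* (z7 :* (:1 :- d :* v :* q :* K :* I))) :* (z8 :* (:1 :- a :* q :* (K :* K :* (I :* q)) :* I))
              := z1 :* z2 :* z3 :* (z4 :* z5) :* (z6 :* z7) :* (z8 :* (:1 :- a :* q :* (K :* K :* (I :* q)) :* I))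
                 :* ((:1 :- e :* v :* (q :* (K :* I))) :* (:1 :- d :* v :* (q :* (K :* I))) :* (:1 :- a :* (K :* K)))) refl
          (ε j) ((v * q) ^ j) (P a j) (P d j) (P e j) (P (e * v * q * K) i) (P (d * v * q * K) i)
          (P (a * q * (K * K * (I * q))) i) d e v a q K I

      f-same : C (K * I) * f j i ≈ Z j i * W₀ K y
      f-same = begin
        C (K * I) * f j i
          ≈⟨ solve 11 (λ w z3 z x y p q M a v g →
                  (:1 :- g) :* (:1 :- a :* q :* (M :* M :* q)) :* (:1 :- v :* q :* M) :* (z :* (w :* z3) :* x :* y :* p)
                  := z :* (w :* z3) :* x :* y :* ((:1 :- a :* q :* (M :* M :* q)) :* (:1 :- v :* q :* M)) :* (p :* (:1 :- g))) refl
                _ _ (ε j * ((v * q) ^ j)) _ _ (P (a * q * (K * K * I)) i) q (K * I) a v (a * q * (K * I * (K * I))) ⟩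
        -- The factor 1 - aqM² of `C` prolongs (aqK²I;q)_i at its end; splitting off the first
        -- factor of the longer product produces the shifted product in `Z`.
        _ ≈⟨ *-congˡ (trans (*-congˡ (+-congˡ (-‿cong (solve 4 (λ a q K I →
                a :* q :* (K :* I :* (K :* I))
                := a :* q :* (K :* K :* I) :* I) refl
               a q K I))))
               (trans (P-suc (a * q * (K * K * I)) i)
                 (*-congˡ (P-cong i (solve 4 (λ a q K I →
                         a :* q :* (K :* K :* I) :* q
                         := a :* q :* (K :* K :* (I :* q))) refl
                        a q K I))))) ⟩
        _ ≈⟨ solve 10 (λ z z3 x y p a v q K I →
                z :* ((:1 :- a :* (K :* K)) :* z3) :* x :* y :* ((:1 :- a :* q :* (K :* I :* (K :* I) :* q)) :* (:1 :- v :* q :* (K :* I)))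
                   :* ((:1 :- a :* q :* (K :* K :* I)) :* p)
                := z :* z3 :* x :* y :* (p :* (:1 :- a :* q :* (K :* K :* (I :* q)) :* I))
                   :* ((:1 :- v :* (q :* (K :* I))) :* (:1 :- a :* (K :* K)) :* (:1 :- a :* (K :* (q :* (K :* I)))))) refl
               (ε j * ((v * q) ^ j)) (P a j) _ _ (P (a * q * (K * K * (I * q))) i) a v q K I ⟩
        Z j i * W₀ K y ∎

    module _ (j i : ℕ) where
      private
        K = q ^ j
        I = q ^ i
        y = q * (K * (I * q))

      Z₂ : Carrier
      Z₂ = ε j * ((v * q) ^ j) * P a j * (P d j * P e j)
        * (P (e * v * q * (K * q)) i * P (d * v * q * (K * q)) i)
        * (P (a * q * (K * q * (K * q) * (I * q))) i * (1# - a * (y * y)))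

      Z-suc : Z j (suc i) ≈ Z₂ * ((1# - e * v * (K * q)) * (1# - d * v * (K * q)) * (1# - a * (K * q * y)))
      Z-suc = begin
        Z j (suc i)
          ≈⟨ *-cong (*-congˡ (*-cong (shift (e * v)) (shift (d * v)))) (*-congʳ (trans (P-suc _ i)
               (*-congˡ (P-cong i (solve 4 (λ a q K I →
                       a :* q :* (K :* K :* (I :* q :* q)) :* q
                       := a :* q :* (K :* q :* (K :* q) :* (I :* q))) refl
                      a q K I))))) ⟩
        _ ≈⟨ solve 11 (λ z p1 p2 p3 d e v a q K I →
                z :* ((:1 :- e :* v :* q :* K) :* p1 :* ((:1 :- d :* v :* q :* K) :* p2))
                   :* ((:1 :- a :* q :* (K :* K :* (I :* q :* q))) :* p3 :* (:1 :- a :* q :* (K :* K :* (I :* q :* q)) :* (I :* q)))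
                := z :* (p1 :* p2) :* (p3 :* (:1 :- a :* (q :* (K :* (I :* q)) :* (q :* (K :* (I :* q))))))
                   :* ((:1 :- e :* v :* (K :* q)) :* (:1 :- d :* v :* (K :* q)) :* (:1 :- a :* (K :* q :* (q :* (K :* (I :* q))))))) refl
               _ _ _ _ d e v a q K I ⟩
        Z₂ * ((1# - e * v * (K * q)) * (1# - d * v * (K * q)) * (1# - a * (K * q * y))) ∎
        where
        shift : ∀ x → P (x * q * K) (suc i) ≈ (1# - x * q * K) * P (x * q * (K * q)) i
        shift x = trans (P-suc _ i) (*-congˡ (P-cong i (*-assoc (x * q) K q)))

      -- What `ε`, the power of vq and the products in a, d, e gain when j becomes j + 1. Multiplied
      -- by q^(i+1) it equals -`W₃ K y`, as needed to cancel the last summand of `φ-split`.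
      c₂ : Carrier
      c₂ = - (K * v * q) * ((1# - d * K) * (1# - e * K) * (1# - a * K))

      f-shift : f (suc j) (suc i) ≈ Z₂ * c₂ * φ (K * q) y
      f-shift = solve 15 (λ e1 x z1 p1 p2 p3 p4 p5 d e v a q K I →
              e1 :* (:- K) :* (x :* (v :* q)) :* ((:1 :- a :* (K :* q :* (K :* q))) :* (z1 :* (:1 :- a :* K))) :* (p1 :* (:1 :- d :* K) :* (p2 :* (:1 :- e :* K)))
                 :* (p3 :* (:1 :- e :* v :* q :* (K :* q) :* I) :* (p4 :* (:1 :- d :* v :* q :* (K :* q) :* I)))
                 :* (p5 :* (:1 :- a :* q :* (K :* q :* (K :* q) :* (I :* q)) :* I))
              := e1 :* x :* z1 :* (p1 :* p2) :* (p3 :* p4) :* (p5 :* (:1 :- a :* (q :* (K :* (I :* q)) :* (q :* (K :* (I :* q))))))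
                 :* (:- (K :* v :* q) :* ((:1 :- d :* K) :* (:1 :- e :* K) :* (:1 :- a :* K)))
                 :* ((:1 :- e :* v :* (q :* (K :* (I :* q)))) :* (:1 :- d :* v :* (q :* (K :* (I :* q)))) :* (:1 :- a :* (K :* q :* (K :* q))))) refl
          (ε j) ((v * q) ^ j) (P a j) (P d j) (P e j) (P (e * v * q * (K * q)) i) (P (d * v * q * (K * q)) i)
          (P (a * q * (K * q * (K * q) * (I * q))) i) d e v a q K I

      ψ-shift : ψ (suc j) (suc i) ≈ Z₂ * c₂ * ρ (K * q) y
      ψ-shift = solve 14 (λ e1 x z1 p1 p2 p p5 d e v a q K I →
              e1 :* (:- K) :* (x :* (v :* q)) :* (z1 :* (:1 :- a :* K)) :* (p1 :* (:1 :- d :* K) :* (p2 :* (:1 :- e :* K))) :* p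
                 :* (p5 :* (:1 :- a :* q :* (K :* q :* (K :* q) :* (I :* q)) :* I))
                 :* (:- (q :* (K :* q :* I) :* ((d :+ e) :* v :- a :* (v :* (K :* q :+ q :* (K :* q :* I)) :+ K :* q :- v :* (a :* (K :* q :* (K :* q :* (q :* (K :* q :* I)))))))))
              := e1 :* x :* z1 :* (p1 :* p2) :* p :* (p5 :* (:1 :- a :* (q :* (K :* (I :* q)) :* (q :* (K :* (I :* q))))))
                 :* (:- (K :* v :* q) :* ((:1 :- d :* K) :* (:1 :- e :* K) :* (:1 :- a :* K)))
                 :* (:- (q :* (K :* (I :* q)) :* ((d :+ e) :* v :- a :* (v :* (K :* q :+ q :* (K :* (I :* q))) :+ K :* q :- v :* (a :* (K :* q :* (K :* q :* (q :* (K :* (I :* q))))))))))) refl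
          (ε j) ((v * q) ^ j) (P a j) (P d j) (P e j) (P (e * v * q * (K * q)) i * P (d * v * q * (K * q)) i)
          (P (a * q * (K * q * (K * q) * (I * q))) i) d e v a q K I

    certificate : ∀ j i → f j (suc i) + (q ^ i) * f (suc j) i + (1# - (q ^ i)) * ψ (suc j) i
      ≈ C ((q ^ j) * (q ^ i)) * f j i + (1# - (q ^ j)) * ψ j (suc i)
    certificate j zero = begin
      f j 1 + 1# * f (suc j) 0 + (1# - 1#) * 0#
        ≈⟨ +-congʳ (+-cong (f-suc j 0) (*-congˡ f-shift₀)) ⟩
      Z j 0 * φ K y + 1# * (Z j 0 * (- W₃ K y)) + (1# - 1#) * 0#
        ≈⟨ +-congʳ (+-congʳ (*-congˡ (φ-split K y))) ⟩
      Z j 0 * (W₀ K y + (1# - K) * ρ K y + W₃ K y) + 1# * (Z j 0 * (- W₃ K y)) + (1# - 1#) * 0#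
        ≈⟨ solve 5 (λ z w k r x →
                z :* (w :+ (:1 :- k) :* r :+ x) :+ :1 :* (z :* (:- x)) :+ (:1 :- :1) :* :0
                := z :* w :+ (:1 :- k) :* (z :* r)) refl
               _ _ _ _ _ ⟩
      Z j 0 * W₀ K y + (1# - K) * ψ j 1
        ≈⟨ +-congʳ (f-same j 0) ⟨
      C (K * 1#) * f j 0 + (1# - K) * ψ j 1 ∎
      where
      K = q ^ j
      y = q * (K * 1#)
      f-shift₀ : f (suc j) 0 ≈ Z j 0 * (- W₃ K y)
      f-shift₀ = solve 11 (λ e1 x z1 p1 p2 d e v a q K →
              e1 :* (:- K) :* (x :* (v :* q)) :* ((:1 :- a :* (K :* q :* (K :* q))) :* (z1 :* (:1 :- a :* K))) :* (p1 :* (:1 :- d :* K) :* (p2 :* (:1 :- e :* K)))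
                 :* (:1 :* :1) :* :1
              := e1 :* x :* z1 :* (p1 :* p2) :* (:1 :* :1) :* (:1 :* (:1 :- a :* q :* (K :* K :* (:1 :* q)) :* :1))
                 :* (:- (v :* (q :* (K :* :1)) :* ((:1 :- d :* K) :* (:1 :- e :* K) :* (:1 :- a :* K))))) refl
          (ε j) ((v * q) ^ j) (P a j) (P d j) (P e j) d e v a q K
    certificate j (suc i) = begin
      f j (suc (suc i)) + I * f (suc j) (suc i) + (1# - I) * ψ (suc j) (suc i)
        ≈⟨ +-cong (+-cong (trans (f-suc j (suc i)) (*-cong (Z-suc j i) (φ-split K y))) (*-congˡ (f-shift j i))) (*-congˡ (ψ-shift j i)) ⟩
      Z₂ j i * X * (W₀ K y + (1# - K) * ρ K y + W₃ K y) + I * (Z₂ j i * c₂ j i * φ (K * q) y) + (1# - I) * (Z₂ j i * c₂ j i * ρ (K * q) y)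
        ≈⟨ solve 11 (λ z X w k r v q I T f s →
                z :* X :* (w :+ (:1 :- k) :* r :+ v :* (q :* (k :* I)) :* T) :+ I :* (z :* (:- (k :* v :* q) :* T) :* f) :+ (:1 :- I) :* (z :* (:- (k :* v :* q) :* T) :* s)
                := z :* X :* w :+ (:1 :- k) :* (z :* X :* r) :+ z :* T :* (k :* v :* q) :* (I :* X :- (I :* f :+ (:1 :- I) :* s))) refl
             (Z₂ j i) X (W₀ K y) K (ρ K y) v q I ((1# - d * K) * (1# - e * K) * (1# - a * K)) (φ (K * q) y) (ρ (K * q) y) ⟩
      Z₂ j i * X * W₀ K y + (1# - K) * (Z₂ j i * X * ρ K y)
        + _ * (I * X - (I * φ (K * q) y + (1# - I) * ρ (K * q) y))
        ≈⟨ +-congˡ (*-congˡ (trans (+-congˡ (-‿cong (ρ-divides K I))) (-‿inverseʳ _))) ⟩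
      Z₂ j i * X * W₀ K y + (1# - K) * (Z₂ j i * X * ρ K y) + _ * 0#
        ≈⟨ trans (+-congˡ (zeroʳ _)) (+-identityʳ _) ⟩
      Z₂ j i * X * W₀ K y + (1# - K) * (Z₂ j i * X * ρ K y)
        ≈⟨ +-cong (*-congʳ (Z-suc j i)) (*-congˡ (*-congʳ (Z-suc j i))) ⟨
      Z j (suc i) * W₀ K y + (1# - K) * ψ j (suc (suc i))
        ≈⟨ +-congʳ (f-same j (suc i)) ⟨
      C (K * I) * f j (suc i) + (1# - K) * ψ j (suc (suc i)) ∎
      where
      K = q ^ j
      I = (q ^ i) * q
      y = q * (K * I)
      X = (1# - e * v * (K * q)) * (1# - d * v * (K * q)) * (1# - a * (K * q * y))

    C-cong : ∀ {M N} → M ≈ N → C M ≈ C N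
    C-cong M≈N = *-cong (*-cong (+-congˡ (-‿cong (*-congˡ (*-cong M≈N M≈N)))) (+-congˡ (-‿cong (*-congˡ (*-congʳ (*-cong M≈N M≈N))))))
      (+-congˡ (-‿cong (*-congˡ M≈N)))

    six-φ-five : ∀ m → Q m f ≈ P a (suc (m ℕ.+ m)) * P (v * q) m
    six-φ-five zero = solve 1 (λ a →
            :1 :* :1 :* ((:1 :- a :* (:1 :* :1)) :* :1) :* (:1 :* :1) :* (:1 :* :1) :* :1
            := :1 :* (:1 :- a :* :1) :* :1) refl
           a
    six-φ-five (suc m) = begin
      Q (suc m) f
        ≈⟨ Q-step m (C (q ^ m)) f ψ (λ { j i ≡.refl → trans (certificate j i) (+-congʳ (*-congʳ (C-cong (sym (^-+ q j i))))) }) ⟩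
      C M * Q m f
        ≈⟨ *-congˡ (six-φ-five m) ⟩
      C M * (P a (suc (m ℕ.+ m)) * P (v * q) m)
        ≈⟨ solve 6 (λ a q v M x y →
                (:1 :- a :* q :* (M :* M)) :* (:1 :- a :* q :* (M :* M :* q)) :* (:1 :- v :* q :* M) :* (x :* y)
                := x :* (:1 :- a :* (M :* M :* q)) :* (:1 :- a :* (M :* M :* q :* q)) :* (y :* (:1 :- v :* q :* M))) refl
               a q v M _ _ ⟩
      P a (suc (m ℕ.+ m)) * (1# - a * (M * M * q)) * (1# - a * (M * M * q * q)) * P (v * q) (suc m)
        ≈⟨ *-congʳ (*-cong (*-congˡ (+-congˡ (-‿cong (*-congˡ (*-congʳ M²))))) (+-congˡ (-‿cong (*-congˡ (*-congʳ (*-congʳ M²)))))) ⟨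
      P a (3 ℕ.+ (m ℕ.+ m)) * P (v * q) (suc m)
        ≡⟨ ≡.cong (λ k → P a (2 ℕ.+ k) * P (v * q) (suc m)) (ℕₚ.+-suc m m) ⟨
      P a (suc (suc m ℕ.+ suc m)) * P (v * q) (suc m) ∎
      where
      M = q ^ m
      M² = ^-+ q m m

  -- Sears' transformation

  P-+′ : ∀ x m j i → P (x * (q ^ m)) (j ℕ.+ i) ≈ P (x * (q ^ m)) j * P (x * (q ^ (m ℕ.+ j))) i
  P-+′ x m j i = trans (P-+ _ j i) (*-congˡ (P-cong i (trans (*-assoc _ _ _) (*-congˡ (sym (^-+ q m j))))))

  -- Φ m z w d e α β is (z , α , β ; q)_m times 4φ3(q^-m, w, d, e; α, β, q^(1-m)/z; q, q), in a form which
  -- survives the vanishing of the denominators.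
  Φ-term : (z w d e α β : Carrier) → ℕ → ℕ → Carrier
  Φ-term z w d e α β j i =
    (z ^ j) * (P d j * P e j) * P w j * P z i * (P (α * (q ^ j)) i * P (β * (q ^ j)) i)

  Φ : ℕ → (z w d e α β : Carrier) → Carrier
  Φ m z w d e α β = Q m (Φ-term z w d e α β)

  -- Expand (ds, es ; q)_j by q-Saalschütz, interchange the sums, and sum the inner one by q-Saalschütz.
  sears : ∀ m s y w d e → Φ m (s * y) w d e (w * y) (d * e * s) ≈ Φ m y w (d * s) (e * s) (w * (s * y)) (d * e * s)
  sears m s y w d e = sym (begin
    Q m (Φ-term y w (d * s) (e * s) (w * (s * y)) (d * e * s))
      ≈⟨ Q-cong m (λ j i _ → trans (expand j i) (trans (*-congˡ (sym (saalschütz j d e s))) (sym (Q-*ˡ j _ _)))) ⟩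
    Q m (λ j i → Q j (λ r t → G j i * A r t))
      -- `Q-assoc` needs the summand as a function of r, t, i alone, so j is eliminated as r + t.
      ≈⟨ Q-cong m (λ j i _ → Q-cong j λ { r t ≡.refl → refl }) ⟩
    Q m (λ j i → Q j (λ r t → G (r ℕ.+ t) i * A r t))
      ≈⟨ Q-assoc m (λ r t i → G (r ℕ.+ t) i * A r t) ⟩
    Q m (λ r n → Q n (λ t i → G (r ℕ.+ t) i * A r t))
      -- The inner sum over t is q-Saalschütz with parameters wq^r and s, and y in the role of s;
      -- its value (wyq^r, sy;q)_n is where sy replaces y.
      ≈⟨ Q-cong m (λ r n _ → trans (Q-cong n (λ { t i ≡.refl → regroup r t i })) (trans (Q-*ˡ n (H r n) _)
           (trans (*-congˡ (saalschütz n (w * (q ^ r)) s y)) (collapse r n)))) ⟩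
    Q m (Φ-term (s * y) w d e (w * y) (d * e * s)) ∎)
    where
    A : ℕ → ℕ → Carrier
    A r t = P d r * P e r * P (d * e * s * (q ^ r)) t * P s t * (s ^ r)

    G : ℕ → ℕ → Carrier
    G j i = (y ^ j) * P w j * P y i * (P (w * (s * y) * (q ^ j)) i * P (d * e * s * (q ^ j)) i)

    H : ℕ → ℕ → Carrier
    H r n = (y ^ r) * (s ^ r) * (P d r * P e r) * P w r * P (d * e * s * (q ^ r)) n

    expand : ∀ j i → Φ-term y w (d * s) (e * s) (w * (s * y)) (d * e * s) j i ≈ G j i * (P (d * s) j * P (e * s) j)
    expand j i = solve 7 (λ a b c d e f g →
            a :* (b :* c) :* d :* e :* (f :* g)
            := a :* d :* e :* (f :* g) :* (b :* c)) refl
           _ _ _ _ _ _ _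

    regroup : ∀ r t i → G (r ℕ.+ t) i * A r t ≈ H r (t ℕ.+ i) *
      (P (w * (q ^ r)) t * P s t * P (w * (q ^ r) * s * y * (q ^ t)) i * P y i * (y ^ t))
    regroup r t i = begin
      G (r ℕ.+ t) i * A r t
        ≈⟨ *-congʳ (*-cong (*-congʳ (*-cong (^-+ y r t) (P-+ w r t)))
             (*-congʳ (P-cong i (trans (*-congˡ (^-+ q r t)) (solve 5 (λ w s y R T →
                     w :* (s :* y) :* (R :* T)
                     := w :* R :* s :* y :* T) refl
                    _ _ _ _ _))))) ⟩
      _ ≈⟨ solve 12 (λ yr yt wr wt yi ws p dr er p' st sr →
              yr :* yt :* (wr :* wt) :* yi :* (ws :* p) :* (dr :* er :* p' :* st :* sr)
              := yr :* sr :* (dr :* er) :* wr :* (p' :* p) :* (wt :* st :* ws :* yi :* yt)) refl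
             (y ^ r) (y ^ t) (P w r) (P (w * (q ^ r)) t) (P y i) (P (w * (q ^ r) * s * y * (q ^ t)) i)
             (P (d * e * s * (q ^ (r ℕ.+ t))) i) (P d r) (P e r) (P (d * e * s * (q ^ r)) t) (P s t) (s ^ r) ⟩
      _ ≈⟨ *-congʳ (*-congˡ (P-+′ (d * e * s) r t i)) ⟨
      _ ∎

    collapse : ∀ r n → H r n * (P (w * (q ^ r) * y) n * P (s * y) n) ≈ Φ-term (s * y) w d e (w * y) (d * e * s) r n
    collapse r n = begin
      H r n * (P (w * (q ^ r) * y) n * P (s * y) n)
        ≈⟨ solve 8 (λ yr sr d e w p x z →
                yr :* sr :* (d :* e) :* w :* p :* (x :* z)
                := sr :* yr :* (d :* e) :* w :* z :* (x :* p)) refl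
               _ _ _ _ _ _ _ _ ⟩
      (s ^ r) * (y ^ r) * (P d r * P e r) * P w r * P (s * y) n * (P (w * (q ^ r) * y) n * P (d * e * s * (q ^ r)) n)
        ≈⟨ *-cong (*-congʳ (*-congʳ (*-congʳ (sym (^-* s y r)))))
             (*-congʳ (P-cong n (solve 3 (λ w R y → w :* R :* y := w :* y :* R) refl _ _ _))) ⟩
      Φ-term (s * y) w d e (w * y) (d * e * s) r n ∎

  -- Watson's transformation

  -- With u = a / (bc), v = a / (de) and K = q^k, this is the k-th term of 8W7(a; b, c, d, e, q^-m) without the
  -- factor [m choose k]_q, multiplied by 1 - a and by all the denominators (aq / · ; q)_m.
  W-term : (a b c d e u v : Carrier) → ℕ → ℕ → Carrier
  W-term a b c d e u v k i = ε k * (((u * q) ^ k) * ((v * q) ^ k)) * ((1# - a * ((q ^ k) * (q ^ k))) * P a k)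
    * (P b k * P c k * (P d k * P e k))
    * (P (c * u * q * (q ^ k)) i * P (b * u * q * (q ^ k)) i * (P (e * v * q * (q ^ k)) i * P (d * v * q * (q ^ k)) i))
    * P (a * q * ((q ^ k) * (q ^ k) * (q ^ i))) i

  module Watson (b c d e u v : Carrier) (balanced : d * e * v ≈ b * c * u) where
    a : Carrier
    a = b * c * u

    private
      B-term = SixPhiFive.f b c u
      Φ-here = Φ-term (v * q) (u * q) d e (c * u * q) (b * u * q)

    -- The cofactor of (a;q)_(2j+1) (uq;q)_j, the value of the 6φ5 sum with parameters b and c; its
    -- last product is the rest of (a;q)_(2m+1).
    G : ℕ → ℕ → Carrier
    G j i = ((v * q) ^ j) * (P d j * P e j) * P (v * q) i * (P (c * u * q * (q ^ j)) i * P (b * u * q * (q ^ j)) i)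
      * P (a * (q ^ suc (j ℕ.+ j))) (i ℕ.+ i)

    H : ℕ → ℕ → Carrier
    H k n = ε k * (((u * q) ^ k) * ((v * q) ^ k)) * ((1# - a * ((q ^ k) * (q ^ k))) * P a k)
      * (P b k * P c k * (P d k * P e k))
      * (P (c * u * q * (q ^ k)) n * P (b * u * q * (q ^ k)) n) * P (a * q * ((q ^ k) * (q ^ k) * (q ^ n))) n

    expand : ∀ j i → P a (suc ((j ℕ.+ i) ℕ.+ (j ℕ.+ i))) * Φ-here j i
      ≈ G j i * (P a (suc (j ℕ.+ j)) * P (u * q) j)
    expand j i = begin
      P a (suc ((j ℕ.+ i) ℕ.+ (j ℕ.+ i))) * Φ-here j i
        ≡⟨ ≡.cong (λ k → P a (suc k) * Φ-here j i) (interchange j i j i) ⟩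
      P a (suc (j ℕ.+ j) ℕ.+ (i ℕ.+ i)) * Φ-here j i
        ≈⟨ *-congʳ (P-+ a (suc (j ℕ.+ j)) (i ℕ.+ i)) ⟩
      P a (suc (j ℕ.+ j)) * P (a * (q ^ suc (j ℕ.+ j))) (i ℕ.+ i) * Φ-here j i
        ≈⟨ solve 7 (λ x y a b c d e →
                x :* y :* (a :* b :* c :* d :* e)
                := a :* b :* d :* e :* y :* (x :* c)) refl
               _ _ _ _ _ _ _ ⟩
      G j i * (P a (suc (j ℕ.+ j)) * P (u * q) j) ∎
      where open import Algebra.Properties.CommutativeSemigroup ℕₚ.+-commutativeSemigroup using (interchange)

    -- Both sides are the product of length l + 2i starting at aq^(1+2k+l), cut after l factors on
    -- the left and after i on the right. Through `balanced` the first i factors become a product of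
    -- the inner Saalschütz sum, and the others depend on l + i only.
    tail : ∀ k l i → P (a * q * ((q ^ k) * (q ^ k) * (q ^ l))) l * P (a * (q ^ suc ((k ℕ.+ l) ℕ.+ (k ℕ.+ l)))) (i ℕ.+ i)
      ≈ P (d * (q ^ k) * (e * (q ^ k)) * (v * q) * (q ^ l)) i * P (a * q * ((q ^ k) * (q ^ k) * (q ^ (l ℕ.+ i)))) (l ℕ.+ i)
    tail k l i = begin
      P x l * P (a * (q ^ suc ((k ℕ.+ l) ℕ.+ (k ℕ.+ l)))) (i ℕ.+ i)
        ≈⟨ *-congˡ (P-cong (i ℕ.+ i) (trans (*-congˡ (*-congʳ (trans (^-+ q (k ℕ.+ l) (k ℕ.+ l)) (*-cong (^-+ q k l) (^-+ q k l)))))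
             (solve 4 (λ a q K L →
                     a :* (K :* L :* (K :* L) :* q)
                     := a :* q :* (K :* K :* L) :* L) refl
                    _ _ _ _))) ⟩
      P x l * P (x * (q ^ l)) (i ℕ.+ i)
        ≈⟨ P-+ x l (i ℕ.+ i) ⟨
      P x (l ℕ.+ (i ℕ.+ i))
        ≡⟨ ≡.cong (P x) (x∙yz≈y∙xz l i i) ⟩
      P x (i ℕ.+ (l ℕ.+ i))
        ≈⟨ P-+ x i (l ℕ.+ i) ⟩
      P x i * P (x * (q ^ i)) (l ℕ.+ i)
        ≈⟨ *-cong
             (P-cong i (trans (*-congʳ (*-congʳ (sym balanced)))
               (solve 6 (λ d e v q K L →
                       d :* e :* v :* q :* (K :* K :* L)
                       := d :* K :* (e :* K) :* (v :* q) :* L) refl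
                      _ _ _ _ _ _)))
             (P-cong (l ℕ.+ i) (trans (solve 5 (λ a q K L I →
                     a :* q :* (K :* K :* L) :* I
                     := a :* q :* (K :* K :* (L :* I))) refl
                    _ _ _ _ _)
               (*-congˡ (*-congˡ (sym (^-+ q l i)))))) ⟩
      _ ∎
      where
      open import Algebra.Properties.CommutativeSemigroup ℕₚ.+-commutativeSemigroup using (x∙yz≈y∙xz)
      x = a * q * ((q ^ k) * (q ^ k) * (q ^ l))

    regroup : ∀ k l i → G (k ℕ.+ l) i * B-term k l ≈ H k (l ℕ.+ i) *
      (P (d * (q ^ k)) l * P (e * (q ^ k)) l * P (d * (q ^ k) * (e * (q ^ k)) * (v * q) * (q ^ l)) i * P (v * q) i * ((v * q) ^ l))
    regroup k l i = begin
      G (k ℕ.+ l) i * B-term k l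
        ≈⟨ *-congʳ (*-congʳ (*-congʳ (*-congʳ (*-cong (^-+ (v * q) k l) (*-cong (P-+ d k l) (P-+ e k l)))))) ⟩
      _ ≈⟨ solve 17 (λ vk vl dk dl ek el vi cl' bl' t e' uk ak bc cl bl s →
              vk :* vl :* (dk :* dl :* (ek :* el)) :* vi :* (cl' :* bl') :* t :* (e' :* uk :* ak :* bc :* (cl :* bl) :* s)
              := e' :* (uk :* vk) :* ak :* (bc :* (dk :* ek)) :* (cl :* cl' :* (bl :* bl')) :* (s :* t) :* (dl :* el :* vi :* vl)) refl
             _ _ (P d k) (P (d * (q ^ k)) l) (P e k) (P (e * (q ^ k)) l) _ _ _ _ (ε k) ((u * q) ^ k)
             ((1# - a * ((q ^ k) * (q ^ k))) * P a k) (P b k * P c k) _ _ _ ⟩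
      _ ≈⟨ *-congʳ (*-cong (*-congˡ (*-cong (sym (P-+′ (c * u * q) k l i)) (sym (P-+′ (b * u * q) k l i)))) (tail k l i)) ⟩
      _ ≈⟨ solve 7 (λ h s t x y z w →
              h :* (s :* t) :* (x :* y :* z :* w)
              := h :* t :* (x :* y :* s :* z :* w)) refl
             _ _ _ _ _ _ _ ⟩
      _ ∎

    collapse : ∀ k n → H k n * (P (d * (q ^ k) * (v * q)) n * P (e * (q ^ k) * (v * q)) n) ≈ W-term a b c d e u v k n
    collapse k n = begin
      H k n * (P (d * (q ^ k) * (v * q)) n * P (e * (q ^ k) * (v * q)) n)
        ≈⟨ *-congˡ (*-cong (shift d) (shift e)) ⟩
      H k n * (P (d * v * q * (q ^ k)) n * P (e * v * q * (q ^ k)) n)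
        ≈⟨ solve 5 (λ h c p d e → h :* c :* p :* (d :* e) := h :* (c :* (e :* d)) :* p) refl _ _ _ _ _ ⟩
      W-term a b c d e u v k n ∎
      where
      shift : ∀ x → P (x * (q ^ k) * (v * q)) n ≈ P (x * v * q * (q ^ k)) n
      shift x = P-cong n (solve 4 (λ x K v q → x :* K :* (v :* q) := x :* v :* q :* K) refl _ _ _ _)

    -- Expand (uq ; q)_j by the 6φ5 sum, interchange the sums, and sum the inner one by q-Saalschütz.
    watson : ∀ m → P a (suc (m ℕ.+ m)) * Φ m (v * q) (u * q) d e (c * u * q) (b * u * q) ≈ Q m (W-term a b c d e u v)
    watson m = begin
      P a (suc (m ℕ.+ m)) * Q m Φ-here
        ≈⟨ Q-*ˡ m _ _ ⟨
      Q m (λ j i → P a (suc (m ℕ.+ m)) * Φ-here j i)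
        ≈⟨ Q-cong m (λ { j i ≡.refl → trans (expand j i) (trans (*-congˡ (sym (SixPhiFive.six-φ-five b c u j))) (sym (Q-*ˡ j _ _))) }) ⟩
      Q m (λ j i → Q j (λ k l → G j i * B-term k l))
        ≈⟨ Q-cong m (λ j i _ → Q-cong j λ { k l ≡.refl → refl }) ⟩
      Q m (λ j i → Q j (λ k l → G (k ℕ.+ l) i * B-term k l))
        ≈⟨ Q-assoc m (λ k l i → G (k ℕ.+ l) i * B-term k l) ⟩
      Q m (λ k n → Q n (λ l i → G (k ℕ.+ l) i * B-term k l))
        ≈⟨ Q-cong m (λ k n _ → trans (Q-cong n (λ { l i ≡.refl → regroup k l i })) (trans (Q-*ˡ n (H k n) _)
             (trans (*-congˡ (saalschütz n (d * (q ^ k)) (e * (q ^ k)) (v * q))) (collapse k n)))) ⟩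
      Q m (W-term a b c d e u v) ∎

  -- Explicit q-binomial coefficients

  ε-≉0 : ∀ k → ¬ q ≈ 0# → ¬ ε k ≈ 0#
  ε-≉0 zero    q≉0     = 1≉0
  ε-≉0 (suc k) q≉0     = *-≉0 (ε-≉0 k q≉0) λ -qᵏ≈0 →
    ^-≉0 k q≉0 (trans (solve 1 (λ x → x := :- (:- x)) refl _) (trans (-‿cong -qᵏ≈0) (solve 0 (:- :0 := :0) refl)))

  Sum : (ℕ → Carrier) → ℕ → Carrier
  Sum f zero    = f 0
  Sum f (suc n) = Sum f n + f (suc n)

  Sum-cong : ∀ n {f g} → (∀ j → j ≤ n → f j ≈ g j) → Sum f n ≈ Sum g n
  Sum-cong zero    f≈g = f≈g 0 z≤n
  Sum-cong (suc n) f≈g = +-cong (Sum-cong n λ j j≤n → f≈g j (ℕₚ.m≤n⇒m≤1+n j≤n)) (f≈g (suc n) ℕₚ.≤-refl)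

  Sum-+ : ∀ n f g → Sum (λ j → f j + g j) n ≈ Sum f n + Sum g n
  Sum-+ zero    f g = refl
  Sum-+ (suc n) f g = trans (+-congʳ (Sum-+ n f g)) (solve 4 (λ a b c d →
          a :+ b :+ (c :+ d)
          := a :+ c :+ (b :+ d)) refl
         _ _ _ _)

  Sum-*ʳ : ∀ n f c → Sum f n * c ≈ Sum (λ j → f j * c) n
  Sum-*ʳ zero    f c = refl
  Sum-*ʳ (suc n) f c = trans (distribʳ _ _ _) (+-congʳ (Sum-*ʳ n f c))

  Sum-head : ∀ n f → Sum f (suc n) ≈ f 0 + Sum (λ j → f (suc j)) n
  Sum-head zero    f = refl
  Sum-head (suc n) f = trans (+-congʳ (Sum-head n f)) (+-assoc _ _ _)

  Sum-truncate : ∀ {m n} f → m ℕ.≤′ n → (∀ j → m < j → f j ≈ 0#) → Sum f n ≈ Sum f m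
  Sum-truncate f ℕ.≤′-refl       f≈0 = refl
  Sum-truncate f (ℕ.≤′-step m≤n) f≈0 =
    trans (+-cong (Sum-truncate f m≤n f≈0) (f≈0 _ (s≤s (ℕₚ.≤′⇒≤ m≤n)))) (+-identityʳ _)

  -- No order between m and n is assumed: the longer sum has only zero terms beyond the end of the
  -- shorter one.
  Sum-match : ∀ m n {f g} → (∀ j → j ≤ m → j ≤ n → f j ≈ g j) →
    (∀ j → n < j → f j ≈ 0#) → (∀ j → m < j → g j ≈ 0#) → Sum f m ≈ Sum g n
  Sum-match m n {f} {g} f≈g f≈0 g≈0 with ℕₚ.≤-total m n
  ... | inj₁ m≤n = trans (Sum-cong m λ j j≤m → f≈g j j≤m (ℕₚ.≤-trans j≤m m≤n)) (sym (Sum-truncate g (ℕₚ.≤⇒≤′ m≤n) g≈0))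
  ... | inj₂ n≤m = trans (Sum-truncate f (ℕₚ.≤⇒≤′ n≤m) f≈0) (Sum-cong n λ j j≤n → f≈g j (ℕₚ.≤-trans j≤n n≤m) j≤n)

  bin : ℕ → ℕ → Carrier
  bin m       zero    = 1#
  bin zero    (suc j) = 0#
  bin (suc m) (suc j) = (q ^ suc j) * bin m (suc j) + bin m j

  bin-vanish : ∀ m j → m < j → bin m j ≈ 0#
  bin-vanish zero    (suc j) _         = refl
  bin-vanish (suc m) (suc j) (s≤s m<j) =
    trans (+-cong (trans (*-congˡ (bin-vanish m (suc j) (ℕₚ.m≤n⇒m≤1+n m<j))) (zeroʳ _)) (bin-vanish m j m<j)) (+-identityʳ _)

  Q-Sum : ∀ m f → Q m f ≈ Sum (λ j → bin m j * f j (m ∸ j)) m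
  Q-Sum zero    f = sym (*-identityˡ _)
  Q-Sum (suc m) f = begin
    Q m (λ j i → (q ^ j) * f j (suc i) + f (suc j) i)
      ≈⟨ Q-Sum m _ ⟩
    Sum (λ j → bin m j * ((q ^ j) * f j (suc (m ∸ j)) + f (suc j) (m ∸ j))) m
      ≈⟨ Sum-cong m (λ j j≤m → trans (solve 4 (λ b x y z →
              b :* (x :* y :+ z)
              := x :* b :* y :+ b :* z) refl
             _ _ _ _)
           (+-congʳ (*-congˡ (reflexive (≡.cong (f j) (≡.sym (ℕₚ.+-∸-assoc 1 j≤m))))))) ⟩
    Sum (λ j → t j + bin m j * f (suc j) (m ∸ j)) m
      ≈⟨ Sum-+ m t _ ⟩
    Sum t m + Sum (λ j → bin m j * f (suc j) (m ∸ j)) m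
      ≈⟨ +-congʳ (trans (sym (+-identityʳ _)) (+-congˡ (sym (trans (*-congʳ (trans (*-congˡ (bin-vanish m (suc m) ℕₚ.≤-refl)) (zeroʳ _))) (zeroˡ _))))) ⟩
    Sum t (suc m) + Sum (λ j → bin m j * f (suc j) (m ∸ j)) m
      ≈⟨ +-congʳ (Sum-head m t) ⟩
    t 0 + Sum (λ j → t (suc j)) m + Sum (λ j → bin m j * f (suc j) (m ∸ j)) m
      ≈⟨ trans (+-assoc _ _ _) (+-cong (*-congʳ (*-identityˡ 1#)) (trans (sym (Sum-+ m _ _)) (Sum-cong m λ j _ → sym (distribʳ _ _ _)))) ⟩
    1# * f 0 (suc m) + Sum (λ j → bin (suc m) (suc j) * f (suc j) (m ∸ j)) m
      ≈⟨ Sum-head m (λ j → bin (suc m) j * f j (suc m ∸ j)) ⟨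
    Sum (λ j → bin (suc m) j * f j (suc m ∸ j)) (suc m) ∎
    where
    t : ℕ → Carrier
    t j = (q ^ j) * bin m j * f j (suc m ∸ j)

  -- falling m j = (1 - q^m)(1 - q^(m-1)) ⋯ (1 - q^(m-j+1))
  falling : ℕ → ℕ → Carrier
  falling m       zero    = 1#
  falling zero    (suc j) = 0#
  falling (suc m) (suc j) = (1# - (q ^ suc m)) * falling m j

  -- The definition adds factors in front; this splits off the last one, 1 - q^(m-j). The power q^j
  -- avoids truncated subtraction, so that j > m is covered.
  falling-suc : ∀ m j → (q ^ j) * falling m (suc j) ≈ ((q ^ j) - (q ^ m)) * falling m j
  falling-suc zero    zero    = solve 0 (:1 :* :0 := (:1 :- :1) :* :1) refl
  falling-suc zero    (suc j) = trans (zeroʳ _) (sym (zeroʳ _))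
  falling-suc (suc m) zero    = solve 1 (λ x → :1 :* ((:1 :- x) :* :1) := (:1 :- x) :* :1) refl _
  falling-suc (suc m) (suc j) = begin
    (q ^ suc j) * ((1# - (q ^ suc m)) * falling m (suc j))
      ≈⟨ solve 4 (λ J M q x →
              J :* q :* ((:1 :- M :* q) :* x)
              := q :* (:1 :- M :* q) :* (J :* x)) refl
             (q ^ j) (q ^ m) q _ ⟩
    _ ≈⟨ *-congˡ (falling-suc m j) ⟩
    _ ≈⟨ solve 4 (λ J M q x →
            q :* (:1 :- M :* q) :* ((J :- M) :* x)
            := (J :* q :- M :* q) :* ((:1 :- M :* q) :* x)) refl
           (q ^ j) (q ^ m) q _ ⟩
    ((q ^ suc j) - (q ^ suc m)) * falling (suc m) (suc j) ∎

  bin-falling : ∀ m j → bin m j * P q j ≈ falling m j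
  bin-falling m       zero    = *-identityˡ _
  bin-falling zero    (suc j) = zeroˡ _
  bin-falling (suc m) (suc j) = begin
    ((q ^ suc j) * bin m (suc j) + bin m j) * P q (suc j)
      ≈⟨ solve 5 (λ J q b x p →
              (J :* q :* b :+ x) :* (p :* (:1 :- q :* J))
              := q :* (J :* (b :* (p :* (:1 :- q :* J)))) :+ (:1 :- q :* J) :* (x :* p)) refl
             (q ^ j) q _ _ _ ⟩
    _ ≈⟨ +-cong (*-congˡ (trans (*-congˡ (bin-falling m (suc j))) (falling-suc m j))) (*-congˡ (bin-falling m j)) ⟩
    _ ≈⟨ solve 4 (λ J M q x →
            q :* ((J :- M) :* x) :+ (:1 :- q :* J) :* x
            := (:1 :- M :* q) :* x) refl
           (q ^ j) (q ^ m) q _ ⟩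
    falling (suc m) (suc j) ∎

  -- The classical link between (q^-m;q)_j / (q;q)_j and the q-binomial coefficient, with r = q^-m
  -- given by its defining equation and negative powers cleared.
  ε-bin : ∀ {r} m → r * (q ^ m) ≈ 1# → ∀ j → ε j * (bin m j * P q j) ≈ P r j * ((q ^ m) ^ j)
  ε-bin {r} m rqᵐ≈1 j = trans (*-congˡ (bin-falling m j)) (ε-falling j)
    where
    ε-falling : ∀ j → ε j * falling m j ≈ P r j * ((q ^ m) ^ j)
    ε-falling zero    = refl
    ε-falling (suc j) = begin
      ε j * (- (q ^ j)) * falling m (suc j)
        ≈⟨ solve 3 (λ e J x → e :* (:- J) :* x := :- (e :* (J :* x))) refl _ _ _ ⟩
      _ ≈⟨ -‿cong (*-congˡ (falling-suc m j)) ⟩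
      _ ≈⟨ solve 4 (λ e J M x → :- (e :* ((J :- M) :* x)) := (M :- :1 :* J) :* (e :* x)) refl _ _ _ _ ⟩
      _ ≈⟨ *-cong (+-congˡ (-‿cong (*-congʳ (sym rqᵐ≈1)))) (ε-falling j) ⟩
      _ ≈⟨ solve 5 (λ M r J p x →
              (M :- r :* M :* J) :* (p :* x)
              := p :* (:1 :- r :* J) :* (x :* M)) refl
             _ _ _ _ _ ⟩
      P r (suc j) * ((q ^ m) ^ suc j) ∎

  -- Reversed products and the change of length

  -- Here t = q^(1-m)/y. Read backwards, the product has the factors 1 - yq^(m-1-l) = -yq^(m-1-l) (1
  -- - tq^l); `ε j` and q^j compensate the signs and the negative powers of q.
  P-reverse : ∀ {t y} m → t * y * (q ^ m) ≈ q → ∀ j i → j ℕ.+ i ≡ m →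
    ε j * (q ^ j) * P (y * (q ^ i)) j ≈ (y ^ j) * P t j * ((q ^ m) ^ j)
  P-reverse         m tyqᵐ≈q zero    i eq = refl
  P-reverse {t} {y} m tyqᵐ≈q (suc j) i eq = begin
    ε j * (- (q ^ j)) * ((q ^ j) * q) * P (y * (q ^ i)) (suc j)
      ≈⟨ *-congˡ (trans (P-suc _ j) (*-congˡ (P-cong j (*-assoc y (q ^ i) q)))) ⟩
    ε j * (- (q ^ j)) * ((q ^ j) * q) * ((1# - y * (q ^ i)) * P (y * (q ^ suc i)) j)
      ≈⟨ solve 6 (λ e J q y I p →
              e :* (:- J) :* (J :* q) :* ((:1 :- y :* I) :* p)
              := (y :* (J :* I :* q) :- q :* J) :* (e :* J :* p)) refl
             _ _ _ _ _ _ ⟩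
    (y * ((q ^ j) * (q ^ i) * q) - q * (q ^ j)) * (ε j * (q ^ j) * P (y * (q ^ suc i)) j)
      ≈⟨ *-cong (+-cong (*-congˡ (trans (*-congʳ (sym (^-+ q j i))) (reflexive (≡.cong (q ^_) eq)))) (-‿cong (*-congʳ (sym tyqᵐ≈q))))
                (P-reverse m tyqᵐ≈q j (suc i) (≡.trans (ℕₚ.+-suc j i) eq)) ⟩
    (y * (q ^ m) - t * y * (q ^ m) * (q ^ j)) * ((y ^ j) * P t j * ((q ^ m) ^ j))
      ≈⟨ solve 7 (λ y M t J a b c →
              (y :* M :- t :* y :* M :* J) :* (a :* b :* c)
              := a :* y :* (b :* (:1 :- t :* J)) :* (c :* M)) refl
             _ _ _ _ _ _ _ ⟩
    (y ^ suc j) * P t (suc j) * ((q ^ m) ^ suc j) ∎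

  P-complement : ∀ {t y} m → t * y * (q ^ m) ≈ q → ∀ j i → j ℕ.+ i ≡ m →
    ε j * (q ^ j) * P y m ≈ P y i * ((y ^ j) * P t j * ((q ^ m) ^ j))
  P-complement {t} {y} m tyqᵐ≈q j i eq = begin
    ε j * (q ^ j) * P y m
      ≈⟨ *-congˡ (trans (reflexive (≡.cong (P y) (≡.trans (≡.sym eq) (ℕₚ.+-comm j i)))) (P-+ y i j)) ⟩
    ε j * (q ^ j) * (P y i * P (y * (q ^ i)) j)
      ≈⟨ solve 3 (λ a b c → a :* (b :* c) := b :* (a :* c)) refl _ _ _ ⟩
    P y i * (ε j * (q ^ j) * P (y * (q ^ i)) j)
      ≈⟨ *-congˡ (P-reverse m tyqᵐ≈q j i eq) ⟩
    P y i * ((y ^ j) * P t j * ((q ^ m) ^ j)) ∎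

  P-split : ∀ x j i {m} → j ℕ.+ i ≡ m → P x m ≈ P x j * P (x * (q ^ j)) i
  P-split x j i ≡.refl = P-+ x j i

  P-vanish : ∀ {w} m j → w * (q ^ m) ≈ 1# → m < j → P w j ≈ 0#
  P-vanish {w} m (suc j) wqᵐ≈1 (s≤s m≤j) with m ℕ.≟ j
  ... | yes ≡.refl = trans (*-congˡ (trans (+-congˡ (-‿cong wqᵐ≈1)) (-‿inverseʳ 1#))) (zeroʳ _)
  ... | no m≢j     = trans (*-congʳ (P-vanish m j wqᵐ≈1 (ℕₚ.≤∧≢⇒< m≤j m≢j))) (zeroˡ _)

  -- The parameters w = q^-n and r = q^-m cut both sums off at the minimum of m and n, where they agree term
  -- by term.
  Φ-change-length : ¬ q ≈ 0# → ∀ m n {w r x p y t} g d e →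
    w * (q ^ n) ≈ 1# → r * (q ^ m) ≈ 1# → p * x * (q ^ n) ≈ q → t * y * (q ^ m) ≈ q →
    Φ m y w d e g p * (P x n * P t n * P g n) ≈ Φ n x r d e t g * (P p m * P y m * P g m)
  Φ-change-length q≉0 m n {w} {r} {x} {p} {y} {t} g d e wqⁿ≈1 rqᵐ≈1 pxqⁿ≈q tyqᵐ≈q = begin
    Φ m y w d e g p * L                         ≈⟨ trans (*-congʳ (Q-Sum m _)) (Sum-*ʳ m _ L) ⟩
    Sum (λ j → bin m j * Y j (m ∸ j) * L) m     ≈⟨ Sum-match m n agree Y-vanish X-vanish ⟩
    Sum (λ j → bin n j * X j (n ∸ j) * R) n     ≈⟨ trans (*-congʳ (Q-Sum n _)) (Sum-*ʳ n _ R) ⟨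
    Φ n x r d e t g * R                         ∎
    where
    -- As p = q^(1-n)/x and t = q^(1-m)/y, both sums are the 4φ3 with upper parameters q^-m, q^-n,
    -- d, e and lower ones g, p, t. The left one is normalised by `R`, the right one by `L`, so each
    -- is multiplied by the normalisation of the other.
    L = P x n * P t n * P g n
    R = P p m * P y m * P g m
    Y = Φ-term y w d e g p
    X = Φ-term x r d e t g

    Y-vanish : ∀ j → n < j → bin m j * Y j (m ∸ j) * L ≈ 0#
    Y-vanish j n<j = begin
      _ ≈⟨ *-congʳ (*-congˡ (*-congʳ (*-congʳ (*-congˡ (P-vanish n j wqⁿ≈1 n<j))))) ⟩
      _ ≈⟨ solve 5 (λ a b c d e → a :* (b :* :0 :* c :* d) :* e := :0) refl _ _ _ _ _ ⟩
      0# ∎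

    X-vanish : ∀ j → m < j → bin n j * X j (n ∸ j) * R ≈ 0#
    X-vanish j m<j = begin
      _ ≈⟨ *-congʳ (*-congˡ (*-congʳ (*-congʳ (*-congˡ (P-vanish m j rqᵐ≈1 m<j))))) ⟩
      _ ≈⟨ solve 5 (λ a b c d e → a :* (b :* :0 :* c :* d) :* e := :0) refl _ _ _ _ _ ⟩
      0# ∎

    agree : ∀ j → j ≤ m → j ≤ n → bin m j * Y j (m ∸ j) * L ≈ bin n j * X j (n ∸ j) * R
    agree j j≤m j≤n = *-cancelˡ-≉0 (*-≉0 (ε-≉0 j q≉0) (^-≉0 j q≉0)) (begin
      ε j * (q ^ j) * (bin m j * Y j i * (P x n * P t n * P g n))
        ≈⟨ solve 6 (λ E b Y x t g →
                E :* (b :* Y :* (x :* t :* g))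
                := b :* Y :* (E :* x :* t :* g)) refl
               _ _ _ _ _ _ ⟩
      _ ≈⟨ *-congˡ (*-cong (*-cong (P-complement n pxqⁿ≈q j k eqₙ) (P-split t j k eqₙ)) (P-split g j k eqₙ)) ⟩
      _ ≈⟨ solve 15 (λ b yj D wj yi gi pi xk xj pj N tj tk gj gk →
              b :* (yj :* D :* wj :* yi :* (gi :* pi)) :* (xk :* (xj :* pj :* N) :* (tj :* tk) :* (gj :* gk))
              := b :* (wj :* N) :* (D :* yj :* yi :* gi :* pi :* xk :* xj :* pj :* tj :* tk :* gj :* gk)) refl
             _ _ _ _ _ _ _ _ _ _ _ _ _ _ _ ⟩
      -- `bin m j * (P w j * ((q ^ n) ^ j))` equals `ε j` times both q-binomial coefficients and
      -- (q;q)_j, which is symmetric in m and n.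
      _ ≈⟨ *-congʳ (trans (*-congˡ (sym (ε-bin n wqⁿ≈1 j))) (trans
             (solve 4 (λ b e c p →
                     b :* (e :* (c :* p))
                     := c :* (e :* (b :* p))) refl
                    _ _ _ _) (*-congˡ (ε-bin m rqᵐ≈1 j)))) ⟩
      _ ≈⟨ solve 15 (λ b yj D rj yi gi pi xk xj pj M tj tk gj gk →
              b :* (rj :* M) :* (D :* yj :* yi :* gi :* pi :* xk :* xj :* pj :* tj :* tk :* gj :* gk)
              := b :* (xj :* D :* rj :* xk :* (tk :* gk)) :* (pj :* pi :* (yi :* (yj :* tj :* M)) :* (gj :* gi))) refl
             _ _ _ _ _ _ _ _ _ _ _ _ _ _ _ ⟩
      _ ≈⟨ *-congˡ (*-cong (*-cong (P-split p j i eqₘ) (P-complement m tyqᵐ≈q j i eqₘ)) (P-split g j i eqₘ)) ⟨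
      _ ≈⟨ solve 6 (λ E b X p y g →
              b :* X :* (p :* (E :* y) :* g)
              := E :* (b :* X :* (p :* y :* g))) refl
             _ _ _ _ _ _ ⟩
      ε j * (q ^ j) * (bin n j * X j k * (P p m * P y m * P g m)) ∎)
      where
      i = m ∸ j
      k = n ∸ j
      eqₘ = ℕₚ.m+[n∸m]≡n j≤m
      eqₙ = ℕₚ.m+[n∸m]≡n j≤n

  Φ-cong : ∀ m {z z′ w w′ d d′ e e′ α α′ β β′} →
    z ≈ z′ → w ≈ w′ → d ≈ d′ → e ≈ e′ → α ≈ α′ → β ≈ β′ → Φ m z w d e α β ≈ Φ m z′ w′ d′ e′ α′ β′
  Φ-cong m z w d e α β = Q-cong m λ j i _ →
    *-cong (*-cong (*-cong (*-cong (^-cong j z) (*-cong (P-cong j d) (P-cong j e))) (P-cong j w)) (P-cong i z))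
      (*-cong (P-cong i (*-congʳ α)) (P-cong i (*-congʳ β)))

  Φ-swap : ∀ m z w d e α β → Φ m z w d e α β ≈ Φ m z w e d α β
  Φ-swap m z w d e α β = Q-cong m λ j i _ → *-congʳ (*-congʳ (*-congʳ (*-congˡ (*-comm _ _))))

  -- Watson's transformation for `W87`

  W-term-cong : ∀ {a a′} b c d e u v k i → a ≈ a′ → W-term a b c d e u v k i ≈ W-term a′ b c d e u v k i
  W-term-cong b c d e u v k i a≈a′ =
    *-cong (*-congʳ (*-congʳ (*-congˡ (*-cong (+-congˡ (-‿cong (*-congʳ a≈a′))) (P-cong k a≈a′)))))
      (P-cong i (*-congʳ (*-congʳ a≈a′)))

  W-term-swap : ∀ a b c d e u v k i → W-term a b c d e u v k i ≈ W-term a d e b c v u k i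
  W-term-swap a b c d e u v k i =
    *-congʳ (*-cong (*-cong (*-congʳ (*-congˡ (*-comm _ _))) (*-comm _ _)) (*-comm _ _))

  P-≉0-≤ : ∀ x {k m} → k ≤ m → ¬ P x m ≈ 0# → ¬ P x k ≈ 0#
  P-≉0-≤ x {k} k≤m Pm≉0 = ≉0-factorˡ (≉0-resp (P-split x k _ (ℕₚ.m+[n∸m]≡n k≤m)) Pm≉0)

  pochs-≉0-≤ : ∀ xs {k m} → k ≤ m → ¬ pochs q xs m ≈ 0# → ¬ pochs q xs k ≈ 0#
  pochs-≉0-≤ []       k≤m ≉0 = ≉0
  pochs-≉0-≤ (x ∷ xs) k≤m ≉0 = *-≉0 (P-≉0-≤ x k≤m (≉0-factorˡ ≉0)) (pochs-≉0-≤ xs k≤m (≉0-factorʳ ≉0))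

  W-Sum : ∀ a xs z m → W q a xs z m ≡ Sum (Wterm q a xs z) m
  W-Sum a xs z zero    = ≡.refl
  W-Sum a xs z (suc m) = ≡.cong (_+ Wterm q a xs z (suc m)) (W-Sum a xs z m)

  -- Here u = a/(bc), v = a/(de) and p = q^-m are given by product equations, and z =
  -- a²q^(m+2)/(bcde) is the argument that Watson's transformation requires.
  module _ (m : ℕ) {a b c d e p z u v : Carrier}
    (b≉0 : ¬ b ≈ 0#) (c≉0 : ¬ c ≈ 0#) (d≉0 : ¬ d ≈ 0#) (e≉0 : ¬ e ≈ 0#)
    (bcu≈a : b * c * u ≈ a) (dev≈a : d * e * v ≈ a)
    (pqᵐ≈1 : p * (q ^ m) ≈ 1#) (z≈ : z ≈ u * q * (v * q) * (q ^ m))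
    (defined : W87-defined q a d e b c p m) where
    private
      a≉1 = proj₁ defined
      Pq≉0 = proj₁ (proj₂ defined)
      duals≉0 = proj₂ (proj₂ defined)

      Duals : Carrier
      Duals = P (c * u * q) m * P (b * u * q) m * (P (e * v * q) m * P (d * v * q) m)

      p≉0 : ¬ p ≈ 0#
      p≉0 = unitˡ-≉0 pqᵐ≈1

      δb : (a * q) / b ≈ c * u * q
      δb = *-unique-/ b≉0 (trans (*-congʳ (sym bcu≈a)) (solve 4 (λ b c u q →
              b :* c :* u :* q
              := b :* (c :* u :* q)) refl
             _ _ _ _))
      δc : (a * q) / c ≈ b * u * q
      δc = *-unique-/ c≉0 (trans (*-congʳ (sym bcu≈a)) (solve 4 (λ b c u q →
              b :* c :* u :* q
              := c :* (b :* u :* q)) refl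
             _ _ _ _))
      δd : (a * q) / d ≈ e * v * q
      δd = *-unique-/ d≉0 (trans (*-congʳ (sym dev≈a)) (solve 4 (λ b c u q →
              b :* c :* u :* q
              := b :* (c :* u :* q)) refl
             _ _ _ _))
      δe : (a * q) / e ≈ d * v * q
      δe = *-unique-/ e≉0 (trans (*-congʳ (sym dev≈a)) (solve 4 (λ b c u q →
              b :* c :* u :* q
              := c :* (b :* u :* q)) refl
             _ _ _ _))
      δp : (a * q) / p ≈ a * q * (q ^ m)
      δp = *-unique-/ p≉0 (begin
        a * q                    ≈⟨ *-identityʳ _ ⟨
        a * q * 1#               ≈⟨ *-congˡ pqᵐ≈1 ⟨
        a * q * (p * (q ^ m))    ≈⟨ solve 3 (λ x p M → x :* (p :* M) := p :* (x :* M)) refl _ _ _ ⟩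
        p * (a * q * (q ^ m))    ∎)

      Den : Carrier
      Den = (1# - a) * Duals * P (a * q * (q ^ m)) m

      params : List Carrier
      params = d ∷ e ∷ b ∷ c ∷ p ∷ []

      term : ∀ k → k ≤ m → Wterm q a params z k * Den ≈ bin m k * W-term a b c d e u v k (m ∸ k)
      -- The factor (q;q)_k is needed by `ε-bin`, which turns (q^-m;q)_k into a q-binomial
      -- coefficient.
      term k k≤m = *-cancelˡ-≉0 (P-≉0-≤ q k≤m Pq≉0) (begin
        P q k * (X * Y * (z ^ k) * Den)
          ≈⟨ *-congˡ (*-congˡ (*-cong (*-congˡ (*-cong (*-cong (split δb) (split δc)) (*-cong (split δd) (split δe)))) split-p)) ⟩
        P q k * (X * Y * (z ^ k) * ((1# - a) * (P (δ b) k * P (c * u * q * K) i * (P (δ c) k * P (b * u * q * K) i)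
            * (P (δ d) k * P (e * v * q * K) i * (P (δ e) k * P (d * v * q * K) i))) * (P (δ p) k * P (a * q * (K * K * I)) i)))
          ≈⟨ solve 15 (λ f X Y z n b b′ c c′ d d′ e e′ p p′ →
                  f :* (X :* Y :* z :* (n :* (b :* b′ :* (c :* c′) :* (d :* d′ :* (e :* e′))) :* (p :* p′)))
                  := X :* n :* (Y :* (f :* (d :* (e :* (b :* (c :* (p :* :1))))))) :* z :* (b′ :* c′ :* (d′ :* e′) :* p′)) refl
                 _ _ _ _ _ _ _ _ _ _ _ _ _ _ _ ⟩
        X * (1# - a) * (Y * D) * (z ^ k) * T
          ≈⟨ *-congʳ (*-cong (*-cong (/-*-cancel _ a≉1) (/-*-cancel _ D≉0)) zᵏ) ⟩
        (1# - a * (q ^ (k ℕ.+ k))) * (P a k * (P d k * (P e k * (P b k * (P c k * (P p k * 1#)))))) * ((u * q) ^ k * ((v * q) ^ k) * ((q ^ m) ^ k)) * T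
          ≈⟨ solve 11 (λ n a d e b c p U V M T →
                  n :* (a :* (d :* (e :* (b :* (c :* (p :* :1)))))) :* (U :* V :* M) :* T
                  := n :* a :* (b :* c :* (d :* e)) :* (U :* V) :* T :* (p :* M)) refl
                 _ _ _ _ _ _ _ _ _ _ _ ⟩
        (1# - a * (q ^ (k ℕ.+ k))) * P a k * (P b k * P c k * (P d k * P e k)) * ((u * q) ^ k * ((v * q) ^ k)) * T * (P p k * ((q ^ m) ^ k))
          ≈⟨ *-cong (*-congʳ (*-congʳ (*-congʳ (*-congʳ (+-congˡ (-‿cong (*-congˡ (^-+ q k k)))))))) (sym (ε-bin m pqᵐ≈1 k)) ⟩
        (1# - a * (K * K)) * P a k * (P b k * P c k * (P d k * P e k)) * ((u * q) ^ k * ((v * q) ^ k)) * T * (ε k * (bin m k * P q k))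
          ≈⟨ solve 8 (λ n x U D p e b f →
                  n :* x :* U :* (D :* p) :* (e :* (b :* f))
                  := f :* (b :* (e :* U :* n :* x :* D :* p))) refl
                 _ _ _ _ _ _ _ _ ⟩
        P q k * (bin m k * W-term a b c d e u v k i) ∎)
        where
        i = m ∸ k
        K = q ^ k
        I = q ^ i
        eq = ℕₚ.m+[n∸m]≡n k≤m
        δ : Carrier → Carrier
        δ x = (a * q) / x
        X = (1# - a * (q ^ (k ℕ.+ k))) / (1# - a)
        Y = (P a k * pochs q params k) / (P q k * pochs q (dualParams q a params) k)
        D = P q k * pochs q (dualParams q a params) k
        T = P (c * u * q * K) i * P (b * u * q * K) i * (P (e * v * q * K) i * P (d * v * q * K) i) * P (a * q * (K * K * I)) i
        D≉0 : ¬ D ≈ 0#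
        D≉0 = *-≉0 (P-≉0-≤ q k≤m Pq≉0) (pochs-≉0-≤ (dualParams q a params) k≤m duals≉0)
        split : ∀ {x y} → x ≈ y → P y m ≈ P x k * P (y * K) i
        split {x} {y} x≈y = trans (P-split y k i eq) (*-congʳ (P-cong k (sym x≈y)))
        split-p : P (a * q * (q ^ m)) m ≈ P (δ p) k * P (a * q * (K * K * I)) i
        split-p = trans (split δp) (*-congˡ (P-cong i (trans
          (*-congʳ (*-congˡ (trans (reflexive (≡.cong (q ^_) (≡.sym eq))) (^-+ q k i))))
          (solve 3 (λ x K I → x :* (K :* I) :* K := x :* (K :* K :* I)) refl _ _ _))))
        zᵏ : z ^ k ≈ (u * q) ^ k * ((v * q) ^ k) * ((q ^ m) ^ k)
        zᵏ = trans (^-cong k z≈) (trans (^-* _ _ k) (*-congʳ (^-* _ _ k)))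

    W87-Q : W87 q a d e b c p z m * Den ≈ Q m (W-term a b c d e u v)
    W87-Q = begin
      W q a params z m * Den                         ≈⟨ *-congʳ (reflexive (W-Sum a params z m)) ⟩
      Sum (Wterm q a params z) m * Den               ≈⟨ Sum-*ʳ m _ Den ⟩
      Sum (λ k → Wterm q a params z k * Den) m       ≈⟨ Sum-cong m term ⟩
      Sum (λ k → bin m k * W-term a b c d e u v k (m ∸ k)) m ≈⟨ Q-Sum m _ ⟨
      Q m (W-term a b c d e u v)                     ∎

    private
      tail≉0 : ¬ P (a * q * (q ^ m)) m ≈ 0#
      tail≉0 = ≉0-resp (P-cong m δp) (≉0-factorˡ (≉0-factorʳ (≉0-factorʳ (≉0-factorʳ (≉0-factorʳ duals≉0)))))

      -- (a;q)_(2m+1) is (1 - a) (aq;q)_m (aq^(m+1);q)_m. The outer two factors also occur in `Den`,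
      -- the last one as the denominator belonging to p, and are nonzero because the series is
      -- defined.
      strip : ∀ S Ψ → S * Den ≈ P a (suc (m ℕ.+ m)) * Ψ → S * Duals ≈ P (a * q) m * Ψ
      strip S Ψ eq = *-cancelˡ-≉0 (*-≉0 a≉1 tail≉0) (begin
        (1# - a) * P (a * q * (q ^ m)) m * (S * Duals)
          ≈⟨ solve 4 (λ n t S D → n :* t :* (S :* D) := S :* (n :* D :* t)) refl _ _ _ _ ⟩
        S * Den
          ≈⟨ eq ⟩
        P a (suc (m ℕ.+ m)) * Ψ
          ≈⟨ *-congʳ (trans (P-suc a (m ℕ.+ m)) (*-congˡ (P-+ (a * q) m m))) ⟩
        (1# - a) * (P (a * q) m * P (a * q * (q ^ m)) m) * Ψ
          ≈⟨ solve 4 (λ n x t y → n :* (x :* t) :* y := n :* t :* (x :* y)) refl _ _ _ _ ⟩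
        (1# - a) * P (a * q * (q ^ m)) m * (P (a * q) m * Ψ) ∎)

    Duals≉0 : ¬ P (c * u * q) m * P (b * u * q) m * (P (e * v * q) m * P (d * v * q) m) ≈ 0#
    Duals≉0 = *-≉0
      (*-≉0 (≉0-resp (P-cong m δb) (≉0-factorˡ (≉0-factorʳ (≉0-factorʳ duals≉0))))
            (≉0-resp (P-cong m δc) (≉0-factorˡ (≉0-factorʳ (≉0-factorʳ (≉0-factorʳ duals≉0))))))
      (*-≉0 (≉0-resp (P-cong m δd) (≉0-factorˡ duals≉0))
            (≉0-resp (P-cong m δe) (≉0-factorˡ (≉0-factorʳ duals≉0))))

    watson-W87 : W87 q a d e b c p z m * Duals ≈ P (a * q) m * Φ m (v * q) (u * q) d e (c * u * q) (b * u * q)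
    watson-W87 = strip _ _ (begin
      W87 q a d e b c p z m * Den                ≈⟨ W87-Q ⟩
      Q m (W-term a b c d e u v)                 ≈⟨ Q-cong m (λ k i _ → W-term-cong b c d e u v k i (sym bcu≈a)) ⟩
      Q m (W-term (b * c * u) b c d e u v)
        ≈⟨ Watson.watson b c d e u v (trans dev≈a (sym bcu≈a)) m ⟨
      P (b * c * u) (suc (m ℕ.+ m)) * _          ≈⟨ *-congʳ (P-cong (suc (m ℕ.+ m)) bcu≈a) ⟩
      P a (suc (m ℕ.+ m)) * _                    ∎)

    -- The 8W7 is symmetric under exchange of the pairs b, c and d, e, but the 4φ3 is not: the pair
    -- summed by the 6φ5 leaves it. Both choices occur in the theorem, one for each series.
    watson-W87′ : W87 q a d e b c p z m * Duals ≈ P (a * q) m * Φ m (u * q) (v * q) b c (e * v * q) (d * v * q)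
    watson-W87′ = strip _ _ (begin
      W87 q a d e b c p z m * Den                ≈⟨ W87-Q ⟩
      Q m (W-term a b c d e u v)
        ≈⟨ Q-cong m (λ k i _ → trans (W-term-swap a b c d e u v k i) (W-term-cong d e b c v u k i (sym dev≈a))) ⟩
      Q m (W-term (d * e * v) d e b c v u)
        ≈⟨ Watson.watson d e b c v u (trans bcu≈a (sym dev≈a)) m ⟨
      P (d * e * v) (suc (m ℕ.+ m)) * _          ≈⟨ *-congʳ (P-cong (suc (m ℕ.+ m)) dev≈a) ⟩
      P a (suc (m ℕ.+ m)) * _                    ∎)

-- The parameters of the theorem

module Transformation {ℓc ℓ : Level} (F : Field ℓc ℓ) where
  open FieldOps F
  open IntegerSolver commutativeRing
  open import Relation.Binary.Reasoning.Setoid setoid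
  open FieldProperties F

  module _ (q a b c : Carrier) (N n m : ℕ) (n≤N : n ≤ N)
    (q≉0 : ¬ q ≈ 0#) (a≉0 : ¬ a ≈ 0#) (b≉0 : ¬ b ≈ 0#) (c≉0 : ¬ c ≈ 0#) where
    open QSeries F q

    -- _/_ binds tighter than _*_: the parameter a * q / c of the theorem is a * (q / c).

    M : ℕ
    M = N ∸ n

    +M : + N ℤ.- + n ≡ + M
    +M = ≡.trans (ℤₚ.m-n≡m⊖n N n) (ℤₚ.⊖-≥ n≤N)

    -- Here w = q^-M, while X = q^(1-M)/p and t = q^(1-m)/y are complementary in the sense of
    -- `P-complement`. The Sears parameter s is determined by sy = c.
    q⁻¹ a⁻¹ b⁻¹ c⁻¹ y r w z₁ A x₁ B X p t g s : Carrier
    q⁻¹ = q ⁻¹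
    a⁻¹ = a ⁻¹
    b⁻¹ = b ⁻¹
    c⁻¹ = c ⁻¹
    y  = q ^ℤ (ℤ.- (+ n))
    r  = q ^ℤ (ℤ.- (+ m))
    w  = q ^ℤ (+ n ℤ.- + N)
    z₁ = q ^ℤ (+ m ℤ.+ + n ℤ.- + N)
    A  = q ^ℤ (+ (2 ℕ.* n) ℤ.- + N)
    x₁ = q ^ℤ (ℤ.- (+ 1) ℤ.- + N)
    B  = q ^ℤ (+ N ℤ.+ + 2)
    X  = x₁ / (a * b)
    p  = a * b * (q ^ (2 ℕ.+ n))
    t  = (q ^ (1 ℕ.+ n)) * r
    g  = c * w
    s  = c * (q ^ n)

    qq⁻¹ = ⁻¹-inverse q q≉0
    aa⁻¹ = ⁻¹-inverse a a≉0
    bb⁻¹ = ⁻¹-inverse b b≉0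
    cc⁻¹ = ⁻¹-inverse c c≉0

    yqⁿ : y * (q ^ n) ≈ 1#
    yqⁿ = ^ℤ-collect q≉0 (ℤ.- (+ n)) (+ n) (ℤₚ.+-inverseˡ (+ n))

    rqᵐ : r * (q ^ m) ≈ 1#
    rqᵐ = ^ℤ-collect q≉0 (ℤ.- (+ m)) (+ m) (ℤₚ.+-inverseˡ (+ m))

    qᴹ : q ^ M ≈ q ^ℤ (+ N ℤ.- + n)
    qᴹ = reflexive (≡.cong (q ^ℤ_) (≡.sym +M))

    wqᴹ : w * (q ^ M) ≈ 1#
    wqᴹ = trans (*-congˡ qᴹ) (^ℤ-collect q≉0 (+ n ℤ.- + N) (+ N ℤ.- + n) (identity (+ n) (+ N)))
      where
      identity : ∀ n N → n ℤ.- N ℤ.+ (N ℤ.- n) ≡ + 0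
      identity = ℤ-Solver.solve-∀

    w≈x₁q¹⁺ⁿ : x₁ * (q ^ (1 ℕ.+ n)) ≈ w
    w≈x₁q¹⁺ⁿ = ^ℤ-collect q≉0 (ℤ.- (+ 1) ℤ.- + N) (+ 1 ℤ.+ + n) (identity (+ n) (+ N))
      where
      identity : ∀ n N → ℤ.- (+ 1) ℤ.- N ℤ.+ (+ 1 ℤ.+ n) ≡ n ℤ.- N
      identity = ℤ-Solver.solve-∀

    wqᵐ≈z₁ : w * (q ^ m) ≈ z₁
    wqᵐ≈z₁ = ^ℤ-collect q≉0 (+ n ℤ.- + N) (+ m) (identity (+ n) (+ m) (+ N))
      where
      identity : ∀ n m N → n ℤ.- N ℤ.+ m ≡ m ℤ.+ n ℤ.- N
      identity = ℤ-Solver.solve-∀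

    yw : y * w ≈ q ^ℤ (ℤ.- (+ N))
    yw = ^ℤ-collect q≉0 (ℤ.- (+ n)) (+ n ℤ.- + N) (identity (+ n) (+ N))
      where
      identity : ∀ n N → ℤ.- n ℤ.+ (n ℤ.- N) ≡ ℤ.- N
      identity = ℤ-Solver.solve-∀

    Bw : B * w ≈ q ^ (2 ℕ.+ n)
    Bw = ^ℤ-collect q≉0 (+ N ℤ.+ + 2) (+ n ℤ.- + N) (identity (+ n) (+ N))
      where
      identity : ∀ n N → N ℤ.+ + 2 ℤ.+ (n ℤ.- N) ≡ + 2 ℤ.+ n
      identity = ℤ-Solver.solve-∀

    wqⁿ≈A : w * (q ^ n) ≈ A
    wqⁿ≈A = ^ℤ-collect q≉0 (+ n ℤ.- + N) (+ n) (≡.trans (identity (+ n) (+ N)) (≡.cong (λ k → + k ℤ.- + N) (≡.cong (n ℕ.+_) (≡.sym (ℕₚ.+-identityʳ n)))))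
      where
      identity : ∀ n N → n ℤ.- N ℤ.+ n ≡ n ℤ.+ n ℤ.- N
      identity = ℤ-Solver.solve-∀

    Aq : A * q ≈ q ^ℤ (+ (2 ℕ.* n) ℤ.- + N ℤ.+ + 1)
    Aq = trans (*-congˡ (sym (*-identityˡ q))) (^ℤ-collect q≉0 (+ (2 ℕ.* n) ℤ.- + N) (+ 1) ≡.refl)

    x₁≈ : x₁ * (q ^ (2 ℕ.+ n)) * (q ^ M) ≈ q
    x₁≈ = trans (*-congʳ (solve 3 (λ x K q →
            x :* (K :* q)
            := x :* K :* q) refl
           _ _ _)) (trans (*-congʳ (*-congʳ w≈x₁q¹⁺ⁿ))
      (trans (solve 3 (λ w q K → w :* q :* K := w :* K :* q) refl _ _ _) (trans (*-congʳ wqᴹ) (*-identityˡ q))))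

    cancel-unit : ∀ {x i} e → x * i ≈ 1# → e * (x * i) ≈ e
    cancel-unit e xi≈1 = trans (*-congˡ xi≈1) (*-identityʳ e)

    ab⁻¹ : Carrier
    ab⁻¹ = (a * b) ⁻¹

    ab·ab⁻¹ : a * b * ab⁻¹ ≈ 1#
    ab·ab⁻¹ = ⁻¹-inverse (a * b) (*-≉0 a≉0 b≉0)

    b·ab⁻¹≈a⁻¹ : b * ab⁻¹ ≈ a⁻¹
    b·ab⁻¹≈a⁻¹ = *-cancelˡ-≉0 a≉0 (trans (sym (*-assoc _ _ _)) (trans ab·ab⁻¹ (sym aa⁻¹)))

    a·ab⁻¹≈b⁻¹ : a * ab⁻¹ ≈ b⁻¹
    a·ab⁻¹≈b⁻¹ = *-cancelˡ-≉0 b≉0 (trans (solve 3 (λ a b i →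
            b :* (a :* i)
            := a :* b :* i) refl
           _ _ _) (trans ab·ab⁻¹ (sym bb⁻¹)))

    q-cancel : ∀ x → x * q⁻¹ * q ≈ x
    q-cancel x = trans (solve 3 (λ x i q → x :* i :* q := x :* (q :* i)) refl _ _ _) (cancel-unit x qq⁻¹)

    -- For the left series u = w/q and v = c/q, so that uq is the second terminating parameter of
    -- the 4φ3. The superscripts ˡ and ʳ distinguish the two series.
    bcuˡ : a * b * B * y * (w * q⁻¹) ≈ a * b * q
    bcuˡ = begin
      a * b * B * y * (w * q⁻¹)                      ≈⟨ solve 6 (λ a b B y w i →
              a :* b :* B :* y :* (w :* i)
              := a :* b :* (B :* w) :* y :* i) refl
             _ _ _ _ _ _ ⟩
      a * b * (B * w) * y * q⁻¹                      ≈⟨ *-congʳ (*-congʳ (*-congˡ Bw)) ⟩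
      a * b * ((q ^ n) * q * q) * y * q⁻¹            ≈⟨ solve 6 (λ a b K q y i →
              a :* b :* (K :* q :* q) :* y :* i
              := a :* b :* q :* (y :* K) :* (q :* i)) refl
             _ _ _ _ _ _ ⟩
      a * b * q * (y * (q ^ n)) * (q * q⁻¹)          ≈⟨ trans (cancel-unit _ qq⁻¹) (cancel-unit _ yqⁿ) ⟩
      a * b * q                                      ∎

    devˡ : b * q * (a * (q / c)) * (c * q⁻¹) ≈ a * b * q
    devˡ = trans (solve 6 (λ a b c j q i →
            b :* q :* (a :* (q :* j)) :* (c :* i)
            := a :* b :* q :* (c :* j) :* (q :* i)) refl
           _ _ _ _ _ _)
      (trans (cancel-unit _ qq⁻¹) (cancel-unit _ cc⁻¹))

    zˡ : c * z₁ ≈ w * q⁻¹ * q * (c * q⁻¹ * q) * (q ^ m)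
    zˡ = sym (begin
      w * q⁻¹ * q * (c * q⁻¹ * q) * (q ^ m)   ≈⟨ *-congʳ (*-cong (q-cancel w) (q-cancel c)) ⟩
      w * c * (q ^ m)                         ≈⟨ solve 3 (λ w c M → w :* c :* M := c :* (w :* M)) refl _ _ _ ⟩
      c * (w * (q ^ m))                       ≈⟨ *-congˡ wqᵐ≈z₁ ⟩
      c * z₁                                  ∎)

    cuqˡ : y * (w * q⁻¹) * q ≈ y * w
    cuqˡ = trans (*-congʳ (sym (*-assoc _ _ _))) (q-cancel (y * w))

    buqˡ : a * b * B * (w * q⁻¹) * q ≈ p
    buqˡ = trans (*-congʳ (sym (*-assoc _ _ _))) (trans (q-cancel _) (trans (*-assoc _ _ _) (*-congˡ Bw)))

    evqˡ : a * (q / c) * (c * q⁻¹) * q ≈ a * q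
    evqˡ = trans (solve 5 (λ a c j q i →
            a :* (q :* j) :* (c :* i) :* q
            := a :* q :* (c :* j) :* (q :* i)) refl
           _ _ _ _ _)
      (trans (cancel-unit _ qq⁻¹) (cancel-unit _ cc⁻¹))

    dvqˡ : b * q * (c * q⁻¹) * q ≈ b * c * q
    dvqˡ = trans (solve 4 (λ b c q i →
            b :* q :* (c :* i) :* q
            := b :* c :* q :* (q :* i)) refl
           _ _ _ _) (cancel-unit _ qq⁻¹)

    sy≈c : s * y ≈ c
    sy≈c = trans (solve 3 (λ c K y → c :* K :* y := c :* (y :* K)) refl _ _ _) (cancel-unit c yqⁿ)

    des≈p : b * q * (a * (q / c)) * s ≈ p
    des≈p = trans (solve 6 (λ a b c j q K →
            b :* q :* (a :* (q :* j)) :* (c :* K)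
            := a :* b :* (K :* q :* q) :* (c :* j)) refl
           _ _ _ _ _ _) (cancel-unit _ cc⁻¹)

    es≈ : a * (q / c) * s ≈ a * (q ^ (1 ℕ.+ n))
    es≈ = trans (solve 5 (λ a c j q K →
            a :* (q :* j) :* (c :* K)
            := a :* (K :* q) :* (c :* j)) refl
           _ _ _ _ _) (cancel-unit _ cc⁻¹)

    ds≈ : b * q * s ≈ b * c * (q ^ (1 ℕ.+ n))
    ds≈ = solve 4 (λ b c q K → b :* q :* (c :* K) := b :* c :* (K :* q)) refl _ _ _ _

    Φˡ Φʳ : Carrier
    Φˡ = Φ m (c * q⁻¹ * q) (w * q⁻¹ * q) (b * q) (a * (q / c)) (y * (w * q⁻¹) * q) (a * b * B * (w * q⁻¹) * q)
    Φʳ = Φ M X r (a * (q ^ (1 ℕ.+ n))) (b * c * (q ^ (1 ℕ.+ n))) t g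

    pXqᴹ : p * X * (q ^ M) ≈ q
    pXqᴹ = trans (solve 6 (λ a b Q x i M →
            a :* b :* Q :* (x :* i) :* M
            := x :* Q :* M :* (a :* b :* i)) refl
           _ _ _ _ _ _) (trans (cancel-unit _ ab·ab⁻¹) x₁≈)

    tyqᵐ : t * y * (q ^ m) ≈ q
    tyqᵐ = trans (solve 5 (λ K q r y M →
            K :* q :* r :* y :* M
            := q :* (y :* K) :* (r :* M)) refl
           _ _ _ _ _) (trans (cancel-unit _ rqᵐ) (cancel-unit _ yqⁿ))

    -- Sears' transformation keeps q^-m, w and the lower parameter p, and multiplies both other
    -- upper parameters by s = cq^n. The lower parameter q^-N becomes g; the third one changes from
    -- q^(1-m)/c to t, since sy is replaced by y. The resulting sum is then reread with length M.
    transformation : Φˡ * (P X M * P t M * P g M) ≈ Φʳ * (P p m * P y m * P g m)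
    transformation = trans (*-congʳ (begin
      Φˡ
        ≈⟨ Φ-cong m (trans (q-cancel c) (sym sy≈c)) (q-cancel w) refl refl (trans cuqˡ (*-comm y w)) (trans buqˡ (sym des≈p)) ⟩
      Φ m (s * y) w (b * q) (a * (q / c)) (w * y) (b * q * (a * (q / c)) * s)
        ≈⟨ sears m s y w (b * q) (a * (q / c)) ⟩
      Φ m y w (b * q * s) (a * (q / c) * s) (w * (s * y)) (b * q * (a * (q / c)) * s)
        ≈⟨ Φ-swap m _ _ _ _ _ _ ⟩
      Φ m y w (a * (q / c) * s) (b * q * s) (w * (s * y)) (b * q * (a * (q / c)) * s)
        ≈⟨ Φ-cong m refl refl es≈ ds≈ (trans (*-congˡ sy≈c) (*-comm w c)) des≈p ⟩
      Φ m y w (a * (q ^ (1 ℕ.+ n))) (b * c * (q ^ (1 ℕ.+ n))) g p ∎))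
      (Φ-change-length q≉0 m M g _ _ wqᴹ rqᵐ pXqᴹ tyqᵐ)

    -- For the right series u = X/q and v = r/q, with aq^(1+n) and bcq^(1+n) as the pair that stays
    -- in the 4φ3.
    bcuʳ : a * (q ^ (1 ℕ.+ n)) * (b * c * (q ^ (1 ℕ.+ n))) * (X * q⁻¹) ≈ c * A
    bcuʳ = begin
      a * (q ^ (1 ℕ.+ n)) * (b * c * (q ^ (1 ℕ.+ n))) * (X * q⁻¹)
        ≈⟨ solve 8 (λ a b c K q x i j →
                a :* (K :* q) :* (b :* c :* (K :* q)) :* (x :* i :* j)
                := c :* (x :* (K :* q) :* K) :* (a :* b :* i) :* (q :* j)) refl
               _ _ _ _ _ _ _ _ ⟩
      c * (x₁ * (q ^ (1 ℕ.+ n)) * (q ^ n)) * (a * b * ab⁻¹) * (q * q⁻¹)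
        ≈⟨ trans (cancel-unit _ qq⁻¹) (cancel-unit _ ab·ab⁻¹) ⟩
      c * (x₁ * (q ^ (1 ℕ.+ n)) * (q ^ n))
        ≈⟨ *-congˡ (trans (*-congʳ w≈x₁q¹⁺ⁿ) wqⁿ≈A) ⟩
      c * A ∎

    devʳ : c * z₁ * (q ^ (1 ℕ.+ n)) * (r * q⁻¹) ≈ c * A
    devʳ = begin
      c * z₁ * (q ^ (1 ℕ.+ n)) * (r * q⁻¹)
        ≈⟨ *-congʳ (*-congʳ (*-congˡ wqᵐ≈z₁)) ⟨
      c * (w * (q ^ m)) * (q ^ (1 ℕ.+ n)) * (r * q⁻¹)
        ≈⟨ solve 7 (λ c w M K q r i →
                c :* (w :* M) :* (K :* q) :* (r :* i)
                := c :* (w :* K) :* (r :* M) :* (q :* i)) refl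
               _ _ _ _ _ _ _ ⟩
      c * (w * (q ^ n)) * (r * (q ^ m)) * (q * q⁻¹)
        ≈⟨ trans (cancel-unit _ qq⁻¹) (cancel-unit _ rqᵐ) ⟩
      c * (w * (q ^ n))
        ≈⟨ *-congˡ wqⁿ≈A ⟩
      c * A ∎

    zʳ : 1# / (a * b * (q ^ (1 ℕ.+ n ℕ.+ m))) ≈ X * q⁻¹ * q * (r * q⁻¹ * q) * (q ^ M)
    zʳ = *-unique-/ (*-≉0 (*-≉0 a≉0 b≉0) (^-≉0 (1 ℕ.+ n ℕ.+ m) q≉0)) (sym (begin
      a * b * (q ^ (1 ℕ.+ n ℕ.+ m)) * (X * q⁻¹ * q * (r * q⁻¹ * q) * (q ^ M))
        ≈⟨ *-cong (*-congˡ (^-+ q (1 ℕ.+ n) m)) (*-congʳ (*-cong (q-cancel X) (q-cancel r))) ⟩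
      a * b * ((q ^ (1 ℕ.+ n)) * (q ^ m)) * (X * r * (q ^ M))
        ≈⟨ solve 8 (λ a b K Q x i r M →
                a :* b :* (K :* Q) :* (x :* i :* r :* M)
                := x :* K :* M :* (r :* Q) :* (a :* b :* i)) refl
               _ _ _ _ _ _ _ _ ⟩
      x₁ * (q ^ (1 ℕ.+ n)) * (q ^ M) * (r * (q ^ m)) * (a * b * ab⁻¹)
        ≈⟨ trans (cancel-unit _ ab·ab⁻¹) (cancel-unit _ rqᵐ) ⟩
      x₁ * (q ^ (1 ℕ.+ n)) * (q ^ M)
        ≈⟨ trans (*-congʳ w≈x₁q¹⁺ⁿ) wqᴹ ⟩
      1# ∎))

    cuqʳ : b * c * (q ^ (1 ℕ.+ n)) * (X * q⁻¹) * q ≈ c * (w / a)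
    cuqʳ = begin
      b * c * (q ^ (1 ℕ.+ n)) * (X * q⁻¹) * q
        ≈⟨ solve 7 (λ b c K x i j q →
                b :* c :* K :* (x :* i :* j) :* q
                := c :* (x :* K :* (b :* i)) :* (q :* j)) refl
               _ _ _ _ _ _ _ ⟩
      c * (x₁ * (q ^ (1 ℕ.+ n)) * (b * ab⁻¹)) * (q * q⁻¹)
        ≈⟨ trans (cancel-unit _ qq⁻¹) (*-congˡ (*-cong w≈x₁q¹⁺ⁿ b·ab⁻¹≈a⁻¹)) ⟩
      c * (w / a) ∎

    buqʳ : a * (q ^ (1 ℕ.+ n)) * (X * q⁻¹) * q ≈ w / b
    buqʳ = begin
      a * (q ^ (1 ℕ.+ n)) * (X * q⁻¹) * q
        ≈⟨ solve 6 (λ a K x i j q →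
                a :* K :* (x :* i :* j) :* q
                := x :* K :* (a :* i) :* (q :* j)) refl
               _ _ _ _ _ _ ⟩
      x₁ * (q ^ (1 ℕ.+ n)) * (a * ab⁻¹) * (q * q⁻¹)
        ≈⟨ trans (cancel-unit _ qq⁻¹) (*-cong w≈x₁q¹⁺ⁿ a·ab⁻¹≈b⁻¹) ⟩
      w / b ∎

    evqʳ : (q ^ (1 ℕ.+ n)) * (r * q⁻¹) * q ≈ t
    evqʳ = trans (*-congʳ (sym (*-assoc _ _ _))) (q-cancel t)

    dvqʳ : c * z₁ * (r * q⁻¹) * q ≈ g
    dvqʳ = begin
      c * z₁ * (r * q⁻¹) * q                       ≈⟨ *-congʳ (*-congʳ (*-congˡ wqᵐ≈z₁)) ⟨
      c * (w * (q ^ m)) * (r * q⁻¹) * q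
        ≈⟨ solve 6 (λ c w M r i q →
                c :* (w :* M) :* (r :* i) :* q
                := c :* w :* (r :* M) :* (q :* i)) refl
               _ _ _ _ _ _ ⟩
      c * w * (r * (q ^ m)) * (q * q⁻¹)            ≈⟨ trans (cancel-unit _ qq⁻¹) (cancel-unit _ rqᵐ) ⟩
      c * w                                        ∎

    -- Comparison of the two series

    z₀ : Carrier
    z₀ = 1# / (a * b * (q ^ (1 ℕ.+ n ℕ.+ m)))

    W87-transformation :
      W87-defined q (a * b * q) (b * q) (a * (q / c)) (a * b * B) y r m →
      W87-defined q (c * A) (c * z₁) (q ^ (1 ℕ.+ n)) (a * (q ^ (1 ℕ.+ n))) (b * c * (q ^ (1 ℕ.+ n))) w M →
      let A⁺ = P (c * (q ^ℤ (+ (2 ℕ.* n) ℤ.- + N ℤ.+ + 1))) M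
          numerator = P (c * (w / a)) M * P (w / b) M * P (a * b * (q ^ℤ (+ 2))) m * P y m * P g m
          denominator = P X M * A⁺ * P (a * q) m * P (q ^ℤ (ℤ.- (+ N))) m * P (b * c * q) m
      in ¬ denominator ≈ 0# →
      W87 q (a * b * q) (b * q) (a * (q / c)) (a * b * B) y r (c * z₁) m
        ≈ (numerator / denominator)
          * W87 q (c * A) (c * z₁) (q ^ (1 ℕ.+ n)) (a * (q ^ (1 ℕ.+ n))) (b * c * (q ^ (1 ℕ.+ n))) w z₀ M
    -- The prefactor collects three normalisations: (abq²;q)_m over (q^-N, p, aq, bcq;q)_m from the
    -- left Watson formula, (cw/a, w/b, t, g;q)_M over (cAq;q)_M from the right one, and (p, y,
    -- g;q)_m over (X, t, g;q)_M from the change of length. The products (p;q)_m and (t, g;q)_M drop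
    -- out.
    W87-transformation definedˡ definedʳ D≉0 = *-cancelˡ-≉0 (*-≉0 D≉0 (*-≉0 (*-≉0 Pp≉0 Pt≉0) Pg≉0)) (begin
      PX * A⁺ * Pa * PN * Pbc * (Pp * Pt * Pg) * Wˡ
        ≈⟨ solve 9 (λ x A a n b p t g W →
                x :* A :* a :* n :* b :* (p :* t :* g) :* W
                := W :* (n :* p :* (a :* b)) :* (x :* t :* g) :* A) refl
               _ _ _ _ _ _ _ _ _ ⟩
      Wˡ * (PN * Pp * (Pa * Pbc)) * (PX * Pt * Pg) * A⁺
        ≈⟨ *-congʳ (*-congʳ leftSeries) ⟩
      Pab * Φˡ * (PX * Pt * Pg) * A⁺
        ≈⟨ *-congʳ (trans (*-assoc _ _ _) (*-congˡ transformation)) ⟩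
      Pab * (Φʳ * (Pp * Py * Pgm)) * A⁺
        ≈⟨ solve 6 (λ a f p y g A →
                a :* (f :* (p :* y :* g)) :* A
                := A :* f :* (a :* (p :* y :* g))) refl
               _ _ _ _ _ _ ⟩
      A⁺ * Φʳ * (Pab * (Pp * Py * Pgm))
        ≈⟨ *-congʳ rightSeries ⟨
      Wʳ * (Pc * Pb * (Pt * Pg)) * (Pab * (Pp * Py * Pgm))
        ≈⟨ solve 9 (λ W c b t g a p y h →
                W :* (c :* b :* (t :* g)) :* (a :* (p :* y :* h))
                := c :* b :* a :* y :* h :* (p :* t :* g) :* W) refl
               _ _ _ _ _ _ _ _ _ ⟩
      Pc * Pb * Pab * Py * Pgm * (Pp * Pt * Pg) * Wʳ
        ≈⟨ *-congʳ (*-congʳ (/-*-cancel _ D≉0)) ⟨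
      _ * (PX * A⁺ * Pa * PN * Pbc) * (Pp * Pt * Pg) * Wʳ
        ≈⟨ solve 4 (λ f D k W → f :* D :* k :* W := D :* k :* (f :* W)) refl _ _ _ _ ⟩
      PX * A⁺ * Pa * PN * Pbc * (Pp * Pt * Pg) * (_ * Wʳ) ∎)
      where
      PX  = P X M
      A⁺  = P (c * (q ^ℤ (+ (2 ℕ.* n) ℤ.- + N ℤ.+ + 1))) M
      Pa  = P (a * q) m
      PN  = P (q ^ℤ (ℤ.- (+ N))) m
      Pbc = P (b * c * q) m
      Pp  = P p m
      Pt  = P t M
      Pg  = P g M
      Pab = P (a * b * (q ^ℤ (+ 2))) m
      Py  = P y m
      Pgm = P g m
      Pc  = P (c * (w / a)) M
      Pb  = P (w / b) M
      Wˡ  = W87 q (a * b * q) (b * q) (a * (q / c)) (a * b * B) y r (c * z₁) m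
      Wʳ  = W87 q (c * A) (c * z₁) (q ^ (1 ℕ.+ n)) (a * (q ^ (1 ℕ.+ n))) (b * c * (q ^ (1 ℕ.+ n))) w z₀ M

      B≉0 : ¬ B ≈ 0#
      B≉0 = ≉0-factorˡ (≉0-resp (sym Bw) (^-≉0 (2 ℕ.+ n) q≉0))

      y≉0 : ¬ y ≈ 0#
      y≉0 = unitˡ-≉0 yqⁿ

      c⁻¹≉0 : ¬ c⁻¹ ≈ 0#
      c⁻¹≉0 = unitʳ-≉0 cc⁻¹

      z₁≉0 : ¬ z₁ ≈ 0#
      z₁≉0 = ≉0-resp wqᵐ≈z₁ (*-≉0 (unitˡ-≉0 wqᴹ) (^-≉0 m q≉0))

      K≉0 : ¬ q ^ (1 ℕ.+ n) ≈ 0#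
      K≉0 = ^-≉0 (1 ℕ.+ n) q≉0

      abB≉0 = *-≉0 (*-≉0 a≉0 b≉0) B≉0
      bq≉0  = *-≉0 b≉0 q≉0
      aq/c≉0 = *-≉0 a≉0 (*-≉0 q≉0 c⁻¹≉0)
      cz₁≉0 = *-≉0 c≉0 z₁≉0
      aK≉0 = *-≉0 a≉0 K≉0
      bcK≉0 = *-≉0 (*-≉0 b≉0 c≉0) K≉0

      leftDuals≉0 = Duals≉0 m abB≉0 y≉0 bq≉0 aq/c≉0 bcuˡ devˡ rqᵐ zˡ definedˡ
      rightDuals≉0 = Duals≉0 M aK≉0 bcK≉0 cz₁≉0 K≉0 bcuʳ devʳ wqᴹ zʳ definedʳ

      Pp≉0 : ¬ Pp ≈ 0#
      Pp≉0 = ≉0-resp (P-cong m buqˡ) (≉0-factorʳ (≉0-factorˡ leftDuals≉0))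

      Pt≉0 : ¬ Pt ≈ 0#
      Pt≉0 = ≉0-resp (P-cong M evqʳ) (≉0-factorˡ (≉0-factorʳ rightDuals≉0))

      Pg≉0 : ¬ Pg ≈ 0#
      Pg≉0 = ≉0-resp (P-cong M dvqʳ) (≉0-factorʳ (≉0-factorʳ rightDuals≉0))

      leftSeries : Wˡ * (PN * Pp * (Pa * Pbc)) ≈ Pab * Φˡ
      leftSeries = begin
        Wˡ * (PN * Pp * (Pa * Pbc))
          ≈⟨ *-congˡ (*-cong (*-cong (P-cong m (trans cuqˡ yw)) (P-cong m buqˡ)) (*-cong (P-cong m evqˡ) (P-cong m dvqˡ))) ⟨
        Wˡ * _
          ≈⟨ watson-W87 m abB≉0 y≉0 bq≉0 aq/c≉0 bcuˡ devˡ rqᵐ zˡ definedˡ ⟩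
        P (a * b * q * q) m * Φˡ
          ≈⟨ *-congʳ (P-cong m (solve 3 (λ a b q → a :* b :* q :* q := a :* b :* (:1 :* q :* q)) refl _ _ _)) ⟩
        Pab * Φˡ ∎

      rightSeries : Wʳ * (Pc * Pb * (Pt * Pg)) ≈ A⁺ * Φʳ
      rightSeries = begin
        Wʳ * (Pc * Pb * (Pt * Pg))
          ≈⟨ *-congˡ (*-cong (*-cong (P-cong M cuqʳ) (P-cong M buqʳ)) (*-cong (P-cong M evqʳ) (P-cong M dvqʳ))) ⟨
        Wʳ * _
          ≈⟨ watson-W87′ M aK≉0 bcK≉0 cz₁≉0 K≉0 bcuʳ devʳ wqᴹ zʳ definedʳ ⟩
        P (c * A * q) M * _
          ≈⟨ *-cong (P-cong M (trans (*-assoc _ _ _) (*-congˡ Aq))) (Φ-cong M (q-cancel X) (q-cancel r) refl refl evqʳ dvqʳ) ⟩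
        A⁺ * Φʳ ∎

theorem2p4 : ∀ {ℓc ℓ : Level} (F : Field ℓc ℓ) →
    let open FieldOps F in
    CharZero →
    (q a b c : Carrier) (N n m : ℕ) →
    0 < m → m ≤ n → n ≤ N →
    ¬ (q ≈ 0#) → ¬ (a ≈ 0#) → ¬ (b ≈ 0#) → ¬ (c ≈ 0#) →
    W87-defined q (a * b * q) (b * q) (a * q / c) (a * b * (q ^ℤ ((+ N) ℤ.+ + 2)))
    (q ^ℤ (ℤ.- (+ n))) (q ^ℤ (ℤ.- (+ m))) m →
    W87-defined q (c * (q ^ℤ ((+ (2 Data.Nat.* n)) ℤ.- + N)))
    (c * (q ^ℤ ((+ m) ℤ.+ (+ n) ℤ.- (+ N)))) (q ^ℤ (+ (1 Data.Nat.+ n)))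
    (a * (q ^ℤ (+ (1 Data.Nat.+ n)))) (b * c * (q ^ℤ (+ (1 Data.Nat.+ n))))
    (q ^ℤ ((+ n) ℤ.- (+ N))) (N ∸ n) →
    ¬ ((poch q ((q ^ℤ (ℤ.- (+ 1) ℤ.- (+ N))) / (a * b)) (N ∸ n)
    * poch q (c * (q ^ℤ ((+ (2 Data.Nat.* n)) ℤ.- (+ N) ℤ.+ (+ 1)))) (N ∸ n)
    * poch q (a * q) m * poch q (q ^ℤ (ℤ.- (+ N))) m * poch q (b * c * q) m) ≈ 0#) →
    W87 q (a * b * q) (b * q) (a * q / c) (a * b * (q ^ℤ ((+ N) ℤ.+ + 2)))
    (q ^ℤ (ℤ.- (+ n))) (q ^ℤ (ℤ.- (+ m)))
    (c * (q ^ℤ ((+ m) ℤ.+ (+ n) ℤ.- (+ N)))) m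
    ≈
    ((poch q (c * (q ^ℤ ((+ n) ℤ.- (+ N))) / a) (N ∸ n)
    * poch q ((q ^ℤ ((+ n) ℤ.- (+ N))) / b) (N ∸ n)
    * poch q (a * b * (q ^ℤ (+ 2))) m * poch q (q ^ℤ (ℤ.- (+ n))) m
    * poch q (c * (q ^ℤ ((+ n) ℤ.- (+ N)))) m)
    / (poch q ((q ^ℤ (ℤ.- (+ 1) ℤ.- (+ N))) / (a * b)) (N ∸ n)
    * poch q (c * (q ^ℤ ((+ (2 Data.Nat.* n)) ℤ.- (+ N) ℤ.+ (+ 1)))) (N ∸ n)
    * poch q (a * q) m * poch q (q ^ℤ (ℤ.- (+ N))) m * poch q (b * c * q) m))
    * W87 q (c * (q ^ℤ ((+ (2 Data.Nat.* n)) ℤ.- + N)))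
    (c * (q ^ℤ ((+ m) ℤ.+ (+ n) ℤ.- (+ N)))) (q ^ℤ (+ (1 Data.Nat.+ n)))
    (a * (q ^ℤ (+ (1 Data.Nat.+ n)))) (b * c * (q ^ℤ (+ (1 Data.Nat.+ n))))
    (q ^ℤ ((+ n) ℤ.- (+ N)))
    (1# / (a * b * (q ^ℤ (+ (1 Data.Nat.+ n Data.Nat.+ m))))) (N ∸ n)
theorem2p4 F _ q a b c N n m _ _ n≤N q≉0 a≉0 b≉0 c≉0 =
  Transformation.W87-transformation F q a b c N n m n≤N q≉0 a≉0 b≉0 c≉0
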